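{- Let $n_1,\ldots,n_t$ be positive integers, and let $t_e$ and $t_o$ be respectively the number of even and odd integers in the sequence $(n_1,\ldots,n_t)$. Let $m$ be a positive integer and $N=82\times35^{2^{t_o}-2}\times 81^{t_e}m$, and suppose that $m\geq n_i\geq 2(\lceil \log N \rceil+1)$ for each $1\leq i\leq t$. Then $$R(C_{n_1},\ldots,C_{n_t},K_{m,m})\leq N.$$
   Context: $C_k$ denotes the cycle on $k$ vertices and $K_{m,m}$ the complete bipartite graph with both parts of size $m$. For graphs $G_1,\ldots,G_k$, the Ramsey number $R(G_1,\ldots,G_k)$ is the smallest integer $N$ such that for every coloring of the edges of the complete graph $K_N$ with colors $1,\ldots,k$ there is, for some $i$, a copy of $G_i$ all of whose edges have color $i$. $\log$ denotes the logarithm to base $2$. -}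

module Defs where

open import Data.Empty using (⊥)
open import Data.Fin.Base using (Fin; toℕ)
open import Data.Integer.Base as ℤ using (ℤ; +_; -[1+_])
open import Data.Nat.Base as ℕ using (ℕ; zero; suc)
open import Data.Nat.Divisibility using (_∣?_)
open import Data.Nat.Properties using (m^n≢0)
open import Data.Product.Base using (_×_; _,_; Σ-syntax; ∃-syntax)
open import Data.Rational.Base as ℚ using (ℚ; _/_)
open import Data.Sum.Base using (_⊎_; inj₁; inj₂; swap)
open import Data.Unit.Base using (⊤; tt)
open import Data.Vec.Base using (Vec; count; lookup)
open import Function.Definitions using (Injective)
open import Relation.Binary.Definitions using (Symmetric; Irreflexive)
open import Relation.Binary.PropositionalEquality.Core using (_≡_; _≢_; refl; ≢-sym)
open import Relation.Nullary.Decidable.Core using (¬?)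

record Graph : Set₁ where
  field
    V      : Set
    Adj    : V → V → Set
    sym    : Symmetric Adj
    irrefl : Irreflexive _≡_ Adj

module _ {k : ℕ} where

  -- j is the cyclic successor of i in 0, 1, …, k - 1.
  Next : Fin k → Fin k → Set
  Next i j = suc (toℕ i) ≡ toℕ j ⊎ (suc (toℕ i) ≡ k × toℕ j ≡ 0)

-- This is the usual C_k for k ≥ 3.  The condition i ≢ j only matters for
-- k = 1, where it removes the loop.
Cycle : ℕ → Graph
Cycle k = record
  { V      = Fin k
  ; Adj    = λ i j → i ≢ j × (Next i j ⊎ Next j i)
  ; sym    = λ (i≢j , e) → ≢-sym i≢j , swap e
  ; irrefl = λ i≡j (i≢j , _) → i≢j i≡j
  }

CompleteBipartite : ℕ → ℕ → Graph
CompleteBipartite a b = record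
  { V      = Fin a ⊎ Fin b
  ; Adj    = Adj
  ; sym    = λ {u} {v} → sym u v
  ; irrefl = λ {u} → irrefl u
  }
  where
  Adj : Fin a ⊎ Fin b → Fin a ⊎ Fin b → Set
  Adj (inj₁ _) (inj₂ _) = ⊤
  Adj (inj₂ _) (inj₁ _) = ⊤
  Adj (inj₁ _) (inj₁ _) = ⊥
  Adj (inj₂ _) (inj₂ _) = ⊥

  sym : ∀ u v → Adj u v → Adj v u
  sym (inj₁ _) (inj₂ _) _ = tt
  sym (inj₂ _) (inj₁ _) _ = tt

  irrefl : ∀ u {v} → u ≡ v → Adj u v → ⊥
  irrefl (inj₁ _) refl ()
  irrefl (inj₂ _) refl ()

-- A colouring of the edges of K_N with k colours.  The diagonal values carry
-- no information: copies of (irreflexive) graphs never look at them.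
record EdgeColouring (N k : ℕ) : Set where
  field
    colour    : Fin N → Fin N → Fin k
    symmetric : ∀ u v → colour u v ≡ colour v u

open EdgeColouring

-- A (not necessarily induced) copy of G all of whose edges have colour i.
MonochromaticCopy : ∀ {N k} → EdgeColouring N k → Fin k → Graph → Set
MonochromaticCopy {N} c i G =
  Σ[ f ∈ (V → Fin N) ]
    Injective _≡_ _≡_ f × (∀ u v → Adj u v → colour c (f u) (f v) ≡ i)
  where open Graph G

Arrows : ∀ {k} → ℕ → Vec Graph k → Set
Arrows {k} N Gs =
  (c : EdgeColouring N k) → ∃[ i ] MonochromaticCopy c i (lookup Gs i)

-- r is the Ramsey number R(G₁, …, G_k).
IsRamseyNumber : ∀ {k} → Vec Graph k → ℕ → Set
IsRamseyNumber Gs r = Arrows r Gs × (∀ M → Arrows M Gs → r ℕ.≤ M)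

infixr 8 _^ℤ_

_^ℤ_ : (b : ℕ) → .{{ℕ.NonZero b}} → ℤ → ℚ
b ^ℤ (+ n)    = + (b ℕ.^ n) / 1
b ^ℤ -[1+ n ] = _/_ (+ 1) (b ℕ.^ suc n) {{m^n≢0 b (suc n)}}

-- ℓ = ⌈log₂ q⌉, i.e. ℓ is the least integer with log₂ q ≤ ℓ; real logarithms
-- are avoided by writing log₂ q ≤ j as q ≤ 2 ^ j (for q > 0).
IsCeilLog₂ : ℚ → ℤ → Set
IsCeilLog₂ q ℓ = q ℚ.≤ 2 ^ℤ ℓ × (∀ j → q ℚ.≤ 2 ^ℤ j → ℓ ℤ.≤ j)

#even : ∀ {t} → Vec ℕ t → ℕ
#even = count (2 ∣?_)

#odd : ∀ {t} → Vec ℕ t → ℕ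
#odd = count (λ n → ¬? (2 ∣? n))

-- 82 × 35^(2^tₒ - 2) × 81^tₑ × m.  It is rational because the exponent of 35
-- is -1 when tₒ = 0.
bound : ∀ {t} → Vec ℕ t → ℕ → ℚ
bound ns m =
  (+ 82 / 1) ℚ.* 35 ^ℤ (+ (2 ℕ.^ #odd ns) ℤ.- + 2) ℚ.* 81 ^ℤ (+ #even ns) ℚ.* (+ m / 1)

{-# OPTIONS --safe #-}
module Submission where

open import Defs
open import Data.Bool.Base using (Bool; true; false; not)
open import Data.Bool.Properties using (not-involutive; not-¬; ¬-not) renaming (_≟_ to _≟ᵇ_)
open import Data.Empty using (⊥; ⊥-elim)
open import Data.Fin.Base as Fin using (Fin; toℕ; fromℕ; inject₁; inject≤; finToFun; funToFin)
open import Data.Fin.Properties as Fin using (finToFun-funToFin)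
open import Data.Fin.Relation.Unary.Top using (view; ‵fromℕ; ‵inject₁)
open import Data.List.Base as List using (List; []; _∷_; _++_; [_]; length; filter; take; drop; reverse; allFin)
import Data.List.Membership.DecPropositional as DecMembership
open import Data.List.Membership.Propositional using (_∈_; _∉_; find; lose)
open import Data.List.Membership.Propositional.Properties
  using (∈-∃++; ∈-filter⁺; ∈-filter⁻; ∈-++⁺ˡ; ∈-++⁺ʳ; ∈-++⁻; ∈-lookup; ∈-map⁺)
open import Data.List.Properties
  using (length-++; length-filter; length-take; length-drop; length-map; length-reverse; length-tabulate;
         take++drop≡id; unfold-reverse; ++-assoc; filter-none)
open import Data.List.Relation.Binary.Disjoint.Propositional using (Disjoint)
open import Data.List.Relation.Binary.Permutation.Propositional using (_↭_; ↭-refl; ↭-sym; ↭-trans; ↭⇒↭ₛ)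
open import Data.List.Relation.Binary.Permutation.Propositional.Properties
  using (∈-resp-↭; ↭-length; shift; ↭-reverse; ++⁺ˡ)
import Data.List.Relation.Binary.Permutation.Setoid.Properties as SetoidPerm
open import Data.List.Relation.Binary.Subset.Propositional using (_⊆_)
open import Data.List.Relation.Unary.All as All using (All; []; _∷_)
import Data.List.Relation.Unary.All.Properties as All
open import Data.List.Relation.Unary.AllPairs using ([]; _∷_)
open import Data.List.Relation.Unary.Any using (Any; here; there; any?)
open import Data.List.Relation.Unary.Unique.Propositional using (Unique)
open import Data.List.Relation.Unary.Unique.Propositional.Properties as Uniq using (Unique[x∷xs]⇒x∉xs)
open import Data.Nat.Base as ℕ using (ℕ; zero; suc; NonZero; _+_; _*_; _∸_; _^_; _≤_; _<_; z≤n; s≤s; z<s)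
open import Data.Nat.Divisibility using (_∣_; _∣?_; divides)
open import Data.Nat.Properties
open import Data.Nat.Tactic.RingSolver using (solve-∀)
open import Data.Product.Base using (∃₂; ∃-syntax; _×_; _,_; proj₁; proj₂)
open import Data.Sum.Base using (_⊎_; inj₁; inj₂)
open import Data.Vec.Base using (Vec; []; _∷_; lookup; map; count; _∷ʳ_)
import Data.Vec.Properties as Vec
open import Function.Base using (_∘_; id; case_of_)
open import Function.Definitions using (Injective)
open import Relation.Binary.Definitions using (DecidableEquality; Symmetric) renaming (Decidable to Decidable₂)
open import Relation.Binary.PropositionalEquality
  using (_≡_; _≢_; refl; sym; trans; cong; cong₂; subst; subst₂; setoid; module ≡-Reasoning)
open import Relation.Nullary using (¬_; Dec; yes; no; ¬?; _×-dec_; _⊎-dec_)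
open import Relation.Nullary.Decidable
  using (does; dec-true; dec-false; map′; decidable-stable; from-yes; _→-dec_)
open import Relation.Unary using (Decidable)

-- Suppose a colour class R is "joined": any M vertices of A and any M vertices
-- of B span an edge of R.  After deleting few vertices, sets of at most M
-- vertices expand by a factor 3, so binary trees of depth K ≈ log₂ M with at
-- least M leaves grow from any vertex.  Given an edge xy, grow such trees from
-- neighbours of x and of y in disjoint regions and join their leaves by a path
-- found by depth-first search in a third region; its length is free, so a cycle
-- of every length n of the right parity arises.  An edge xy between A and B
-- gives even n, an edge xy inside A gives odd n.
--
-- Hence, in the absence of the cycles, colours can be eliminated one at a time
-- by passing to a hole, a pair of sets spanning no edge of the colours treated
-- so far.  An even colour costs a factor 81 on both sides.  For an odd colour
-- the previous colours are used twice: a large hole makes the new colour joined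
-- between A and B, and a small hole inside A provides the edge xy; so the
-- factor c becomes c (34 + c).  A hole of all the cycle colours is a K_{m,m} of
-- the last colour.

-- Lists without repetition and walks

-- Reduces a linear inequality to a hypothesis p ≤ q, a slack s and a semiring identity.
≤-by : ∀ {x y p q} s → p ≤ q → x + q + s ≡ y + p → x ≤ y
≤-by {x} {y} {p} {q} s p≤q eq = +-cancelʳ-≤ p x y (begin
  x + p      ≤⟨ +-monoʳ-≤ x p≤q ⟩
  x + q      ≤⟨ m≤m+n (x + q) s ⟩
  x + q + s  ≡⟨ eq ⟩
  y + p      ∎)
  where open ≤-Reasoning

module _ {A : Set} where

  unique-resp-↭ : ∀ {xs ys : List A} → xs ↭ ys → Unique xs → Unique ys
  unique-resp-↭ p = SetoidPerm.Unique-resp-↭ (setoid A) (↭⇒↭ₛ p)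

  ∈⇒↭∷ : ∀ {x : A} {xs} → x ∈ xs → ∃[ ys ] xs ↭ x ∷ ys
  ∈⇒↭∷ x∈xs with ys , zs , refl ← ∈-∃++ x∈xs = ys ++ zs , shift _ ys zs

  -- Finite sets are lists without repetition, so this is the counting principle of the whole proof:
  -- an estimate covers one such list by a concatenation of others.
  length-⊆ : ∀ {xs ys : List A} → Unique xs → xs ⊆ ys → length xs ≤ length ys
  length-⊆ {[]}     _             _  = z≤n
  length-⊆ {x ∷ xs} u@(_ ∷ uxs) xs⊆ys with zs , p ← ∈⇒↭∷ (xs⊆ys (here refl)) =
    subst (suc (length xs) ≤_) (sym (↭-length p)) (s≤s (length-⊆ uxs xs⊆zs))
    where
    xs⊆zs : xs ⊆ zs
    xs⊆zs v∈xs with ∈-resp-↭ p (xs⊆ys (there v∈xs))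
    ... | here refl  = ⊥-elim (Unique[x∷xs]⇒x∉xs u v∈xs)
    ... | there v∈zs = v∈zs

  unique-++ˡ : ∀ xs {ys : List A} → Unique (xs ++ ys) → Unique xs
  unique-++ˡ []       _         = []
  unique-++ˡ (x ∷ xs) (px ∷ u) =
    All.tabulate (λ v∈ → All.lookup px (∈-++⁺ˡ v∈)) ∷ unique-++ˡ xs u

  unique-++ʳ : ∀ xs {ys : List A} → Unique (xs ++ ys) → Unique ys
  unique-++ʳ []       u       = u
  unique-++ʳ (x ∷ xs) (_ ∷ u) = unique-++ʳ xs u

  unique-++-disjoint : ∀ xs {ys : List A} → Unique (xs ++ ys) → Disjoint xs ys
  unique-++-disjoint (x ∷ xs) (px ∷ _) (here refl , v∈ys) = All.lookup px (∈-++⁺ʳ xs v∈ys) refl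
  unique-++-disjoint (x ∷ xs) (_ ∷ u)  (there v∈ , v∈ys)  = unique-++-disjoint xs u (v∈ , v∈ys)

  take-⊆ : ∀ k (xs : List A) → take k xs ⊆ xs
  take-⊆ k xs v∈ = subst (_ ∈_) (take++drop≡id k xs) (∈-++⁺ˡ v∈)

  unique-reverse : ∀ {xs : List A} → Unique xs → Unique (reverse xs)
  unique-reverse {xs} = unique-resp-↭ (↭-sym (↭-reverse xs))

  length-take-≤ : ∀ {k} (xs : List A) → k ≤ length xs → length (take k xs) ≡ k
  length-take-≤ {k} xs k≤ = trans (length-take k xs) (m≤n⇒m⊓n≡m k≤)

module _ {V : Set} (R : V → V → Set) where

  -- The list holds all visited vertices, both ends included, so a path is a walk whose list is
  -- `Unique`.
  data Walk : V → List V → V → Set where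
    stop : ∀ {v} → Walk v [ v ] v
    step : ∀ {u w v xs} → R u w → Walk w xs v → Walk u (u ∷ xs) v

  -- A path together with an edge from its end back to its start; for `n` at least 3 this is a copy
  -- of the cycle on `n` vertices.
  ClosedWalk : ℕ → Set
  ClosedWalk n = ∃₂ λ u v → ∃[ xs ] Walk u xs v × R v u × Unique xs × length xs ≡ n

module _ {V : Set} {R : V → V → Set} where

  walk-start∈ : ∀ {u xs v} → Walk R u xs v → u ∈ xs
  walk-start∈ stop       = here refl
  walk-start∈ (step _ _) = here refl

  walk-end∈ : ∀ {u xs v} → Walk R u xs v → v ∈ xs
  walk-end∈ stop       = here refl
  walk-end∈ (step _ w) = there (walk-end∈ w)

  walk-++ : ∀ {u xs v w ys z} → Walk R u xs v → R v w → Walk R w ys z → Walk R u (xs ++ ys) z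
  walk-++ stop       e w′ = step e w′
  walk-++ (step d w) e w′ = step d (walk-++ w e w′)

  walk-reverse : Symmetric R → ∀ {u xs v} → Walk R u xs v → Walk R v (reverse xs) u
  walk-reverse s stop = stop
  walk-reverse s (step {u} {xs = xs} e w) =
    subst (λ ys → Walk R _ ys u) (sym (unfold-reverse u xs))
      (walk-++ (walk-reverse s w) (s e) stop)

  walk-take : ∀ {u xs v} k → Walk R u xs v → ∃[ w ] Walk R u (take (suc k) xs) w
  walk-take zero    stop       = _ , stop
  walk-take (suc _) stop       = _ , stop
  walk-take zero    (step _ _) = _ , stop
  walk-take (suc k) (step e w) = _ , step e (proj₂ (walk-take k w))

  walk-map : ∀ {Q : V → V → Set} → (∀ {u v} → R u v → Q u v) → ∀ {u xs v} → Walk R u xs v → Walk Q u xs v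
  walk-map f stop       = stop
  walk-map f (step e w) = step (f e) (walk-map f w)

module _ {V : Set} {R : V → V → Set} (R? : Decidable₂ R) (R-sym : Symmetric R) where

  -- Depth-first search: xs is the stack, S the finished and T the unvisited
  -- vertices, so no edge ever joins S to T; a walk that stays shorter than q
  -- forces S to grow until it has s elements.
  dfs : ∀ (q s : ℕ) (Z : List V) →
        (∀ xs S T → xs ++ S ++ T ↭ Z → length S ≡ s → length xs ≤ suc q →
          ¬ (∀ {a b} → a ∈ S → b ∈ T → ¬ R a b)) →
        s + suc q ≤ length Z → Unique Z →
        ∃₂ λ u v → ∃[ xs ] Walk R u xs v × length xs ≡ suc q × Unique xs × xs ⊆ Z
  dfs q s Z separated enough uZ =
    go (suc (length Z + length Z)) [] [] Z (inj₁ refl) ↭-refl z≤n z≤n (λ ())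
      (s≤s (≤-reflexive (+-identityʳ _)))
    where
    Stack : List V → Set
    Stack xs = xs ≡ [] ⊎ ∃₂ λ u v → Walk R u xs v

    Result : Set
    Result = ∃₂ λ u v → ∃[ xs ] Walk R u xs v × length xs ≡ suc q × Unique xs × xs ⊆ Z

    push-↭ : ∀ xs S {T t T′} → xs ++ S ++ T ↭ Z → T ↭ t ∷ T′ → (t ∷ xs) ++ S ++ T′ ↭ Z
    push-↭ xs S {T} {t} {T′} p T↭ = ↭-trans (↭-trans
      (subst₂ (λ as bs → t ∷ as ↭ bs) (++-assoc xs S T′) (++-assoc xs S (t ∷ T′))
        (↭-sym (shift t (xs ++ S) T′)))
      (++⁺ˡ xs (++⁺ˡ S (↭-sym T↭)))) p

    push-fuel : ∀ a b f → suc (a + a + suc b) + suc f + 0 ≡ f + suc (suc a + suc a + b)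
    push-fuel = solve-∀

    pop-fuel : ∀ a b f → suc (a + b) + suc f + 0 ≡ f + suc (a + suc b)
    pop-fuel = solve-∀

    pop : ∀ {u xs v} → Walk R u xs v → ∃[ ys ] xs ≡ u ∷ ys × Stack ys
    pop stop       = _ , refl , inj₁ refl
    pop (step _ w) = _ , refl , inj₂ (_ , _ , w)

    -- Both moves decrease twice the length of `T` plus the length of the stack: a push takes a
    -- vertex from `T` and lengthens the stack by one, a pop only shortens the stack.
    go : ∀ fuel xs S T → Stack xs → xs ++ S ++ T ↭ Z → length xs ≤ suc q → length S ≤ s →
         (∀ {a b} → a ∈ S → b ∈ T → ¬ R a b) →
         length T + length T + length xs < fuel → Result
    go (suc fuel) xs S T st p |xs|≤ |S|≤ sep fu with length xs ≟ suc q | length S ≟ s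
    go (suc fuel) _ S T (inj₁ refl) p |xs|≤ |S|≤ sep fu | yes () | _
    go (suc fuel) xs S T (inj₂ (u , v , w)) p |xs|≤ |S|≤ sep fu | yes |xs|≡ | _ =
      u , v , xs , w , |xs|≡ , unique-++ˡ xs (unique-resp-↭ (↭-sym p) uZ) , ∈-resp-↭ p ∘ ∈-++⁺ˡ
    go (suc fuel) xs S T st p |xs|≤ |S|≤ sep fu | no _ | yes |S|≡ =
      ⊥-elim (separated xs S T p |S|≡ |xs|≤ sep)
    go (suc fuel) _ S [] (inj₁ refl) p |xs|≤ |S|≤ sep fu | no _ | no |S|≢ =
      -- Stack and `T` are empty, so the at most `s` vertices of `S` would be all of `Z`, against
      -- `enough`.
      ⊥-elim (<-irrefl (↭-length p) (begin-strict
        length (S ++ [])  ≡⟨ trans (length-++ S) (+-identityʳ _) ⟩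
        length S          ≤⟨ |S|≤ ⟩
        s                 <⟨ m<m+n s z<s ⟩
        s + suc q         ≤⟨ enough ⟩
        length Z          ∎))
      where open ≤-Reasoning
    go (suc fuel) _ S (t ∷ T) (inj₁ refl) p |xs|≤ |S|≤ sep fu | no _ | no |S|≢ =
      go fuel [ t ] S T (inj₂ (t , t , stop)) (push-↭ [] S p ↭-refl) (s≤s z≤n) |S|≤
        (λ a∈ b∈ → sep a∈ (there b∈))
        (≤-by 0 fu (push-fuel (length T) 0 fuel))
    go (suc fuel) xs S T (inj₂ (u , v , w)) p |xs|≤ |S|≤ sep fu | no |xs|≢ | no |S|≢
      with any? (R? u) T
    ... | yes ut with t , t∈T , Rut ← find ut with T′ , T↭ ← ∈⇒↭∷ t∈T =
      go fuel (t ∷ xs) S T′ (inj₂ (t , v , step (R-sym Rut) w)) (push-↭ xs S p T↭)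
        (≤∧≢⇒< |xs|≤ |xs|≢) |S|≤
        (λ a∈ b∈ → sep a∈ (∈-resp-↭ (↭-sym T↭) (there b∈)))
        (≤-by 0 (subst (λ l → l + l + length xs < suc fuel) (↭-length T↭) fu)
          (push-fuel (length T′) (length xs) fuel))
    ... | no ¬ut with ys , refl , st ← pop w =
      go fuel ys (u ∷ S) T st (↭-trans (shift u ys (S ++ T)) p)
        (≤-trans (n≤1+n _) |xs|≤) (≤∧≢⇒< |S|≤ |S|≢)
        (λ { (here refl) b∈ Rab → ¬ut (lose b∈ Rab) ; (there a∈) → sep a∈ })
        (≤-by 0 fu (pop-fuel (length T + length T) (length ys) fuel))

-- Expansion and bipartite joined graphs

-- The side reached from side `b` along `k` edges of a bipartite graph; parity arguments become
-- equations between such values.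
flips : ℕ → Bool → Bool
flips zero    b = b
flips (suc k) b = not (flips k b)

flips-+ : ∀ j k b → flips j (flips k b) ≡ flips (j + k) b
flips-+ zero    k b = refl
flips-+ (suc j) k b = cong not (flips-+ j k b)

flips-double : ∀ k b → flips (k + k) b ≡ b
flips-double zero    b = refl
flips-double (suc k) b = trans (cong (not ∘ λ j → flips j b) (+-suc k k))
  (trans (not-involutive _) (flips-double k b))

module Expansion {V : Set} (_≟_ : DecidableEquality V) {R : V → V → Set} (R? : Decidable₂ R) where

  open DecMembership _≟_ using (_∉?_)

  infixl 6 _∖_
  _∖_ : List V → List V → List V
  X ∖ D = filter (_∉? D) X

  neighbours : List V → List V → List V
  neighbours U Y = filter (λ y → any? (λ u → R? u y) U) Y

  neighbours⁺ : ∀ {U Y u y} → u ∈ U → y ∈ Y → R u y → y ∈ neighbours U Y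
  neighbours⁺ u∈ y∈ r = ∈-filter⁺ _ y∈ (lose u∈ r)

  neighbours⁻ : ∀ {U Y y} → y ∈ neighbours U Y → y ∈ Y × ∃[ u ] u ∈ U × R u y
  neighbours⁻ {U} {Y} y∈ with y∈Y , a ← ∈-filter⁻ (λ y → any? (λ u → R? u y) U) {xs = Y} y∈ = y∈Y , find a

  Expanding : ℕ → List V → Set
  Expanding M Y = ∀ U → Unique U → U ⊆ Y → length U ≤ M → 3 * length U ≤ length (neighbours U Y)

  -- Badly expanding sets are collected into D; their union expands badly too,
  -- so the hypothesis stops the process before D has 2 M elements.
  clean : ∀ M X → Unique X → 0 < M →
          (∀ D → Unique D → D ⊆ X → 2 * M ≤ length D → length D ≤ 3 * M →
            ¬ (length (neighbours D (X ∖ D)) ≤ 3 * length D)) →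
          ¬ ¬ (∃[ D ] length D ≤ 2 * M × Expanding M (X ∖ D))
  clean M X uX 0<M large-expand κ =
    -- `2 * M` rounds suffice, since each adds a nonempty set to `D`. The last argument is the
    -- invariant that `D` itself expands badly.
    go (2 * M) [] [] (λ ()) (*-mono-≤ {1} {2} (s≤s z≤n) 0<M) (≤-reflexive (sym (+-identityʳ _)))
      (≤-reflexive (cong length (filter-none _ {X ∖ []} (All.universal (λ _ ()) _))))
    where
    go : ∀ fuel D → Unique D → D ⊆ X → length D < 2 * M → 2 * M ≤ fuel + length D →
         length (neighbours D (X ∖ D)) ≤ 3 * length D → ⊥
    go zero    D uD D⊆X |D|< fu few = <-irrefl refl (<-≤-trans |D|< fu)
    go (suc f) D uD D⊆X |D|< fu few = κ (D , <⇒≤ |D|< , expanding)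
      where
      expanding : Expanding M (X ∖ D)
      expanding U uU U⊆ |U|≤ with 3 * length U ≤? length (neighbours U (X ∖ D))
      ... | yes p = p
      ... | no ¬p = ⊥-elim contra
        where
        D′ : List V
        D′ = U ++ D

        |D′| : length D′ ≡ length U + length D
        |D′| = length-++ U

        uD′ : Unique D′
        uD′ = Uniq.++⁺ uU uD (λ (∈U , ∈D) → proj₂ (∈-filter⁻ (_∉? D) {xs = X} (U⊆ ∈U)) ∈D)

        D′⊆X : D′ ⊆ X
        D′⊆X ∈D′ with ∈-++⁻ U ∈D′
        ... | inj₁ ∈U = proj₁ (∈-filter⁻ (_∉? D) {xs = X} (U⊆ ∈U))
        ... | inj₂ ∈D = D⊆X ∈D

        -- Outside `D′`, a neighbour of the union is a neighbour of `U` or of `D` in `X ∖ D`, so the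
        -- two bad bounds add up to one for the union.
        N⊆ : neighbours D′ (X ∖ D′) ⊆ neighbours U (X ∖ D) ++ neighbours D (X ∖ D)
        N⊆ {y} y∈ with y∈X∖D′ , u , u∈ , r ← neighbours⁻ {D′} y∈
          with y∈X , y∉D′ ← ∈-filter⁻ (_∉? D′) {xs = X} y∈X∖D′ =
          let y∈X∖D = ∈-filter⁺ (_∉? D) y∈X (λ y∈D → y∉D′ (∈-++⁺ʳ U y∈D)) in
          case ∈-++⁻ U u∈ of λ where
            (inj₁ u∈U) → ∈-++⁺ˡ (neighbours⁺ u∈U y∈X∖D r)
            (inj₂ u∈D) → ∈-++⁺ʳ (neighbours U (X ∖ D)) (neighbours⁺ u∈D y∈X∖D r)

        few′ : length (neighbours D′ (X ∖ D′)) ≤ 3 * length D′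
        few′ = begin
          length (neighbours D′ (X ∖ D′))
            ≤⟨ length-⊆ (Uniq.filter⁺ _ (Uniq.filter⁺ (_∉? D′) uX)) N⊆ ⟩
          length (neighbours U (X ∖ D) ++ neighbours D (X ∖ D))
            ≡⟨ length-++ (neighbours U (X ∖ D)) ⟩
          length (neighbours U (X ∖ D)) + length (neighbours D (X ∖ D))
            ≤⟨ +-mono-≤ (<⇒≤ (≰⇒> ¬p)) few ⟩
          3 * length U + 3 * length D
            ≡⟨ *-distribˡ-+ 3 (length U) (length D) ⟨
          3 * (length U + length D)
            ≡⟨ cong (3 *_) |D′| ⟨
          3 * length D′ ∎
          where open ≤-Reasoning

        0<|U| : 0 < length U
        0<|U| with length U
        ... | zero  = ⊥-elim (¬p z≤n)
        ... | suc _ = z<s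

        contra : ⊥
        -- `U` has at most `M` and `D` fewer than `2 * M` vertices, so a union that reaches `2 * M`
        -- stays within `3 * M`, the range that `large-expand` excludes.
        contra with length D′ <? 2 * M
        contra | no ≮ = large-expand D′ uD′ D′⊆X (≮⇒≥ ≮)
          (subst (_≤ 3 * M) (sym |D′|) (+-mono-≤ |U|≤ (<⇒≤ |D|<))) few′
        contra | yes |D′|< = go f D′ uD′ D′⊆X |D′|< (begin
          2 * M                         ≤⟨ fu ⟩
          suc f + length D              ≡⟨ +-suc f (length D) ⟨
          f + (1 + length D)            ≤⟨ +-monoʳ-≤ f (+-monoˡ-≤ (length D) 0<|U|) ⟩
          f + (length U + length D)     ≡⟨ cong (f +_) |D′| ⟨
          f + length D′                 ∎) few′
          where open ≤-Reasoning

module Bipartite {V : Set} (_≟_ : DecidableEquality V) {R : V → V → Set} (R? : Decidable₂ R)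
                 (R-sym : Symmetric R) (side : V → Bool) where

  open DecMembership _≟_ using (_∈?_; _∉?_)

  -- Trees and connecting paths use only edges between the two sides. The single edge `xy` of the
  -- final cycle may be any edge of `R`.
  H : V → V → Set
  H u v = R u v × side v ≡ not (side u)

  H? : Decidable₂ H
  H? u v = R? u v ×-dec (side v ≟ᵇ not (side u))

  H-sym : Symmetric H
  H-sym {u} {v} (r , eq) = R-sym r , trans (sym (not-involutive (side u))) (cong not (sym eq))

  open Expansion _≟_ H? public

  onSide : Bool → List V → List V
  onSide b = filter (λ v → side v ≟ᵇ b)

  onSide⁻ : ∀ b xs {v} → v ∈ onSide b xs → v ∈ xs × side v ≡ b
  onSide⁻ b xs = ∈-filter⁻ (λ v → side v ≟ᵇ b) {xs = xs}

  onSide⁺ : ∀ {b xs v} → v ∈ xs → side v ≡ b → v ∈ onSide b xs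
  onSide⁺ = ∈-filter⁺ (λ v → side v ≟ᵇ _)

  onSide-unique : ∀ {b xs} → Unique xs → Unique (onSide b xs)
  onSide-unique = Uniq.filter⁺ _

  cnt : Bool → List V → ℕ
  cnt b xs = length (onSide b xs)

  cnt-true+false : ∀ xs → cnt true xs + cnt false xs ≡ length xs
  cnt-true+false []       = refl
  cnt-true+false (x ∷ xs) with side x
  ... | true  = cong suc (cnt-true+false xs)
  ... | false = trans (+-suc (cnt true xs) _) (cong suc (cnt-true+false xs))

  large-side : ∀ {M} xs → 2 * M ≤ length xs → ∃[ b ] M ≤ cnt b xs
  large-side {M} xs 2M≤ with M ≤? cnt true xs
  ... | yes M≤ = true , M≤
  ... | no  M≰ = false , ≤-by 0
    (≤-trans (subst (2 * M ≤_) (sym (cnt-true+false xs)) 2M≤) (+-monoˡ-≤ (cnt false xs) (<⇒≤ (≰⇒> M≰))))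
    (arith M (cnt false xs))
    where
    arith : ∀ m c → m + (m + c) + 0 ≡ c + 2 * m
    arith = solve-∀

  _⟨_⟩⊇_ : List V → Bool → List V → Set
  W ⟨ b ⟩⊇ S = ∀ {v} → v ∈ S → v ∈ W × side v ≡ b

  Joined : ℕ → List V → Set
  Joined M W = ∀ b S T → Unique S → Unique T → W ⟨ b ⟩⊇ S → W ⟨ not b ⟩⊇ T →
    M ≤ length S → M ≤ length T → ∃₂ λ s t → s ∈ S × t ∈ T × R s t

  opposite : ∀ {b u v} → side u ≡ b → side v ≡ not b → R u v → H u v
  opposite refl eq r = r , eq

  module _ {M W} (joined : Joined M W) where

    -- A set `D` of `2 * M` to `3 * M` vertices has `M` of them on one side. If it expanded badly,
    -- `M` vertices of `X` on the other side would avoid both `D` and its neighbours, against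
    -- `Joined`.
    clean-bipartite : ∀ X → 0 < M → Unique X → X ⊆ W → (∀ b → 13 * M ≤ cnt b X) →
      ¬ ¬ (∃[ Y ] Unique Y × Y ⊆ X × Expanding M Y × (∀ b → M ≤ cnt b Y))
    clean-bipartite X 0<M uX X⊆W big κ = clean M X uX 0<M large-expand λ (D , |D|≤ , ex) →
      κ (X ∖ D , Uniq.filter⁺ _ uX , proj₁ ∘ ∈-filter⁻ (_∉? D) , ex , λ b → still-big b D |D|≤)
      where
      still-big : ∀ b D → length D ≤ 2 * M → M ≤ cnt b (X ∖ D)
      still-big b D |D|≤ = ≤-by (10 * M)
        (≤-trans (≤-trans (big b) (subst (cnt b X ≤_) (length-++ (onSide b (X ∖ D)))
          (length-⊆ (onSide-unique uX) cover))) (+-monoʳ-≤ (cnt b (X ∖ D)) |D|≤))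
        (arith M (cnt b (X ∖ D)))
        where
        arith : ∀ m c → m + (c + 2 * m) + 10 * m ≡ c + 13 * m
        arith = solve-∀
        cover : onSide b X ⊆ onSide b (X ∖ D) ++ D
        cover {v} v∈ with v∈X , sv ← onSide⁻ b X v∈ with v ∈? D
        ... | yes v∈D = ∈-++⁺ʳ (onSide b (X ∖ D)) v∈D
        ... | no  v∉D = ∈-++⁺ˡ (onSide⁺ (∈-filter⁺ (_∉? D) v∈X v∉D) sv)

      large-expand : ∀ D → Unique D → D ⊆ X → 2 * M ≤ length D → length D ≤ 3 * M →
        ¬ (length (neighbours D (X ∖ D)) ≤ 3 * length D)
      large-expand D uD D⊆X 2M≤ ≤3M few with b , M≤ ← large-side D 2M≤
        = contra (joined b (onSide b D) T (onSide-unique uD) uT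
                  (λ v∈ → let v∈D , sv = onSide⁻ b D v∈ in X⊆W (D⊆X v∈D) , sv)
                  (λ v∈ → let v∈X , sv = onSide⁻ (not b) X (proj₁ (T⁻ v∈)) in X⊆W v∈X , sv)
                  M≤ M≤|T|)
        where
        N : List V
        N = neighbours D (X ∖ D)
        T : List V
        T = onSide (not b) X ∖ (D ++ N)
        uT : Unique T
        uT = Uniq.filter⁺ _ (onSide-unique uX)
        T⁻ : ∀ {v} → v ∈ T → v ∈ onSide (not b) X × v ∉ D ++ N
        T⁻ = ∈-filter⁻ (_∉? (D ++ N))
        cover : onSide (not b) X ⊆ T ++ (D ++ N)
        cover {v} v∈ with v ∈? (D ++ N)
        ... | yes v∈′ = ∈-++⁺ʳ T v∈′
        ... | no  v∉  = ∈-++⁺ˡ (∈-filter⁺ (_∉? (D ++ N)) v∈ v∉)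
        M≤|T| : M ≤ length T
        -- 13 = 1 + 3 + 9: the other side loses at most `3 * M` vertices to `D` and `9 * M` to its
        -- neighbours.
        M≤|T| = ≤-by 0 (begin
          13 * M                            ≤⟨ big (not b) ⟩
          cnt (not b) X                     ≤⟨ length-⊆ (onSide-unique uX) cover ⟩
          length (T ++ (D ++ N))            ≡⟨ trans (length-++ T) (cong (length T +_) (length-++ D)) ⟩
          length T + (length D + length N)  ≤⟨ +-monoʳ-≤ (length T) (+-mono-≤ ≤3M (≤-trans few (*-monoʳ-≤ 3 ≤3M))) ⟩
          length T + (3 * M + 3 * (3 * M))  ∎) (arith M (length T))
          where
          open ≤-Reasoning
          arith : ∀ m c → m + (c + (3 * m + 3 * (3 * m))) + 0 ≡ c + 13 * m
          arith = solve-∀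
        contra : ¬ (∃₂ λ s t → s ∈ onSide b D × t ∈ T × R s t)
        contra (s , t , s∈ , t∈ , r) with s∈D , ss ← onSide⁻ b D s∈ with t∈X′ , t∉ ← T⁻ t∈
          with t∈X , st ← onSide⁻ (not b) X t∈X′ =
          t∉ (∈-++⁺ʳ D (neighbours⁺ s∈D
            (∈-filter⁺ (_∉? D) t∈X (t∉ ∘ ∈-++⁺ˡ)) (opposite ss st r)))

    isolated : List V → List V → List V
    isolated L = filter (λ z → ¬? (any? (λ l → H? l z) L))

    -- More than `M` vertices of `E` without a neighbour in `L` would contradict `Joined`.
    few-isolated : ∀ {b L E} → Unique L → W ⟨ b ⟩⊇ L → M ≤ length L →
      Unique E → W ⟨ not b ⟩⊇ E → length (isolated L E) ≤ M
    few-isolated {b} {L} {E} uL L⊆ M≤ uE E⊆ with length (isolated L E) ≤? M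
    ... | yes p = p
    ... | no ¬p with s , t , s∈ , t∈ , r ←
          joined b L (isolated L E) uL (Uniq.filter⁺ _ uE) L⊆
            (E⊆ ∘ proj₁ ∘ ∈-filter⁻ (λ z → ¬? (any? (λ l → H? l z) L)) {xs = E}) M≤ (<⇒≤ (≰⇒> ¬p))
          with t∈E , none ← ∈-filter⁻ (λ z → ¬? (any? (λ l → H? l z) L)) {xs = E} t∈ =
      ⊥-elim (none (lose s∈ (opposite (proj₂ (L⊆ s∈)) (proj₂ (E⊆ t∈E)) r)))

    -- Suppose that `2 * M` vertices are finished; then `M` of them lie on one side. Of the `4 * M`
    -- vertices of `Z` on the other side at most `M` are on the stack and `2 * M` finished, so `M`
    -- are unvisited, and `Joined` gives an edge that separation forbids.
    dfs-bipartite : ∀ q Z → suc q ≤ M → Unique Z → Z ⊆ W → (∀ b → 4 * M ≤ cnt b Z) →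
      ∃₂ λ u v → ∃[ xs ] Walk H u xs v × length xs ≡ suc q × Unique xs × xs ⊆ Z
    dfs-bipartite q Z q<M uZ Z⊆W big = dfs H? H-sym q (2 * M) Z separated enough uZ
      where
      enough : 2 * M + suc q ≤ length Z
      enough = begin
        2 * M + suc q    ≤⟨ +-monoʳ-≤ (2 * M) q<M ⟩
        2 * M + M        ≤⟨ ≤-by {p = 0} M z≤n (arith M) ⟩
        4 * M            ≤⟨ big true ⟩
        cnt true Z       ≤⟨ length-filter _ Z ⟩
        length Z         ∎
        where
        open ≤-Reasoning
        arith : ∀ m → 2 * m + m + 0 + m ≡ 4 * m + 0
        arith = solve-∀
      separated : ∀ xs S T → xs ++ S ++ T ↭ Z → length S ≡ 2 * M → length xs ≤ suc q →
        ¬ (∀ {a b} → a ∈ S → b ∈ T → ¬ H a b)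
      separated xs S T p |S| |xs|≤ sep with b , M≤ ← large-side S (≤-reflexive (sym |S|))
        = contra (joined b (onSide b S) (onSide (not b) T)
          (onSide-unique (unique-++ˡ S (unique-++ʳ xs u)))
          (onSide-unique (unique-++ʳ S (unique-++ʳ xs u)))
          (λ v∈ → let v∈S , sv = onSide⁻ b S v∈ in Z⊆W (∈-resp-↭ p (∈-++⁺ʳ xs (∈-++⁺ˡ v∈S))) , sv)
          (λ v∈ → let v∈T , sv = onSide⁻ (not b) T v∈ in Z⊆W (∈-resp-↭ p (∈-++⁺ʳ xs (∈-++⁺ʳ S v∈T))) , sv)
          M≤ M≤T)
        where
        contra : ¬ (∃₂ λ s t → s ∈ onSide b S × t ∈ onSide (not b) T × R s t)
        contra (s , t , s∈ , t∈ , r) with s∈S , ss ← onSide⁻ b S s∈ with t∈T , st ← onSide⁻ (not b) T t∈ =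
          sep s∈S t∈T (opposite ss st r)
        u : Unique (xs ++ S ++ T)
        u = unique-resp-↭ (↭-sym p) uZ
        M≤T : M ≤ cnt (not b) T
        M≤T = ≤-by 0 (begin
          4 * M                                          ≤⟨ big (not b) ⟩
          cnt (not b) Z                                  ≤⟨ length-⊆ (onSide-unique uZ) cover ⟩
          length (xs ++ S ++ onSide (not b) T)           ≡⟨ trans (length-++ xs) (cong (length xs +_) (length-++ S)) ⟩
          length xs + (length S + cnt (not b) T)
            ≤⟨ +-mono-≤ (≤-trans |xs|≤ q<M) (+-monoˡ-≤ (cnt (not b) T) (≤-reflexive |S|)) ⟩
          M + (2 * M + cnt (not b) T)                    ∎) (arith M (cnt (not b) T))
          where
          open ≤-Reasoning
          arith : ∀ m c → m + (m + (2 * m + c)) + 0 ≡ c + 4 * m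
          arith = solve-∀
          cover : onSide (not b) Z ⊆ xs ++ S ++ onSide (not b) T
          cover v∈ with v∈Z , sv ← onSide⁻ (not b) Z v∈ with ∈-++⁻ xs (∈-resp-↭ (↭-sym p) v∈Z)
          ... | inj₁ v∈xs = ∈-++⁺ˡ v∈xs
          ... | inj₂ v∈ with ∈-++⁻ S v∈
          ...   | inj₁ v∈S = ∈-++⁺ʳ xs (∈-++⁺ˡ v∈S)
          ...   | inj₂ v∈T = ∈-++⁺ʳ xs (∈-++⁺ʳ S (onSide⁺ v∈T sv))

-- Binary trees and cycles of prescribed length

splice : ∀ {V : Set} {R : V → V → Set} → Symmetric R →
  ∀ {X Y Z : List V} {lX ps x₀ x y lY rs y₀ u zs v} →
  Disjoint X Y → Disjoint X Z → Disjoint Y Z →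
  x ∉ X → x ∉ Y → x ∉ Z → y ∉ X → y ∉ Y → y ∉ Z → x ≢ y →
  Walk R lX ps x₀ → Unique ps → ps ⊆ X → R x₀ x → R x y → R y y₀ →
  Walk R lY rs y₀ → Unique rs → rs ⊆ Y → R lY u →
  Walk R u zs v → Unique zs → zs ⊆ Z → R v lX →
  ClosedWalk R (length ps + (2 + (length rs + length zs)))
splice {V} R-sym {X} {Y} {Z} {lX} {ps} {x₀} {x} {y} {lY} {rs} {y₀} {u} {zs} {v}
  X#Y X#Z Y#Z x∉X x∉Y x∉Z y∉X y∉Y y∉Z x≢y
  wp up ps⊆X rx rxy ry wr ur rs⊆Y ru wz uzs zs⊆Z rv =
  -- Around the cycle: from the leaf `lX` down to the root `x₀`, through `x` and `y`, up from the
  -- root `y₀` to the leaf `lY`, along `zs`, and from `v` back to `lX`.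
  lX , v , ps ++ tail ,
  walk-++ wp rx
    (step rxy (step ry
      (walk-++ (walk-reverse R-sym wr) ru wz))) ,
  rv ,
  Uniq.++⁺ up (x∉tail ∷ y∉tail ∷ utail) ps#tail ,
  total
  where
  tail : List V
  tail = x ∷ y ∷ (reverse rs ++ zs)
  rev⊆Y : reverse rs ⊆ Y
  rev⊆Y = rs⊆Y ∘ ∈-resp-↭ (↭-reverse rs)
  outside : ∀ {t} → t ∉ Y → t ∉ Z → ∀ {v} → v ∈ reverse rs ++ zs → t ≢ v
  outside t∉Y t∉Z v∈ refl with ∈-++⁻ (reverse rs) v∈
  ... | inj₁ v∈rs = t∉Y (rev⊆Y v∈rs)
  ... | inj₂ v∈zs = t∉Z (zs⊆Z v∈zs)
  utail : Unique (reverse rs ++ zs)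
  utail = Uniq.++⁺ (unique-reverse ur) uzs (λ (a , b) → Y#Z (rev⊆Y a , zs⊆Z b))
  x∉tail : All (x ≢_) (y ∷ reverse rs ++ zs)
  x∉tail = x≢y ∷ All.tabulate (outside x∉Y x∉Z)
  y∉tail : All (y ≢_) (reverse rs ++ zs)
  y∉tail = All.tabulate (outside y∉Y y∉Z)
  ps#tail : Disjoint ps tail
  ps#tail (a , here refl)         = x∉X (ps⊆X a)
  ps#tail (a , there (here refl)) = y∉X (ps⊆X a)
  ps#tail (a , there (there b)) with ∈-++⁻ (reverse rs) b
  ... | inj₁ b∈ = X#Y (ps⊆X a , rev⊆Y b∈)
  ... | inj₂ b∈ = X#Z (ps⊆X a , zs⊆Z b∈)
  total : length (ps ++ tail) ≡ length ps + (2 + (length rs + length zs))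
  total = trans (length-++ ps) (cong (λ j → length ps + (2 + j))
    (trans (length-++ (reverse rs)) (cong (_+ length zs) (length-reverse rs))))

module BipartiteCycle {V : Set} (_≟_ : DecidableEquality V) {R : V → V → Set} (R? : Decidable₂ R)
                      (R-sym : Symmetric R) (side : V → Bool) where

  open DecMembership _≟_ using (_∈?_; _∉?_)
  open Bipartite _≟_ R? R-sym side

  walk-side : ∀ {u xs v k} → Walk H u xs v → length xs ≡ suc k → side v ≡ flips k (side u)
  walk-side stop refl = refl
  walk-side {k = suc k} (step {u} (_ , su) w) eq =
    trans (walk-side w (suc-injective eq))
      (trans (cong (flips k) su) (trans (flips-+ k 1 (side u)) (cong (λ j → flips j (side u)) (+-comm k 1))))
  walk-side {k = zero} (step _ stop) ()
  walk-side {k = zero} (step _ (step _ _)) ()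

  -- Consecutive vertices lie on different sides, so one spare vertex buys the choice of the
  -- starting side: drop either the last vertex or the first.
  trim : ∀ {u xs v k} b → Walk H u xs v → length xs ≡ suc (suc k) → Unique xs →
    ∃₂ λ u′ v′ → ∃[ ys ] Walk H u′ ys v′ × length ys ≡ suc k × Unique ys × ys ⊆ xs × side u′ ≡ b
  trim {u} {xs} {v} {k} b w eq uxs with side u ≟ᵇ b
  ... | yes su = u , proj₁ w′ , take (suc k) xs , proj₂ w′ ,
                 length-take-≤ xs (subst (suc k ≤_) (sym eq) (n≤1+n _)) ,
                 Uniq.take⁺ (suc k) uxs , take-⊆ (suc k) xs , su
    where w′ = walk-take k w
  trim {u} {xs} {v} {k} b (step {w = u′} {xs = ys} (_ , su′) w) eq (_ ∷ uys) | no su =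
    u′ , v , ys , w , suc-injective eq , uys , there ,
    trans su′ (trans (cong not (¬-not su)) (not-involutive b))

  -- The tree is kept implicitly: `level` is its front, `used` the union of the earlier levels, and
  -- each front vertex carries its branch to the root. Branches stay within `level ++ used`, so that
  -- a vertex outside both extends them without repetition.
  record Level (Y : List V) (root : V) (i : ℕ) : Set where
    field
      {used level}   : List V
      level-unique   : Unique level
      level-length   : length level ≡ 2 ^ i
      used-length    : length used ≤ 2 ^ i
      level-side     : ∀ {l} → l ∈ level → side l ≡ flips i (side root)
      level-⊆        : level ⊆ Y
      walk           : ∀ {l} → l ∈ level → ∃[ xs ] Walk H l xs root × Unique xs ×
                         length xs ≡ suc i × xs ⊆ Y × xs ⊆ level ++ used

  -- A level of `2 ^ i` vertices has at least `3 * 2 ^ i` neighbours. Removing the at most `2 ^ i`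
  -- earlier vertices leaves a level of twice the size. Expansion applies to at most `M` vertices,
  -- hence the limit `2 * M` for the new level.
  grow : ∀ {M Y root} → Unique Y → Expanding M Y → root ∈ Y → ∀ i → 2 ^ i ≤ 2 * M → Level Y root i
  grow {root = root} uY ex r∈Y zero _ = record
    { used         = []
    ; level        = [ root ]
    ; level-unique = [] ∷ []
    ; level-length = refl
    ; used-length  = z≤n
    ; level-side   = λ { (here refl) → refl }
    ; level-⊆      = λ { (here refl) → r∈Y }
    ; walk         = λ { (here refl) → [ root ] , stop , [] ∷ [] , refl ,
                         (λ { (here refl) → r∈Y }) , ∈-++⁺ˡ }
    }
  grow {M} {Y} {root} uY ex r∈Y (suc i) 2^≤ = record
    { used         = level ++ used
    ; level        = L′
    ; level-unique = Uniq.take⁺ _ (Uniq.filter⁺ _ (Uniq.filter⁺ _ uY))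
    ; level-length = length-take-≤ F enough
    ; used-length  = subst₂ _≤_ (sym (length-++ level)) (cong (2 ^ i +_) (sym (+-identityʳ _)))
                       (+-mono-≤ (≤-reflexive level-length) used-length)
    ; level-side   = λ l∈ → let _ , l₀ , l₀∈ , (_ , sl) = L′⁻ l∈ in trans sl (cong not (level-side l₀∈))
    ; level-⊆      = λ l∈ → let l∈Y , _ = L′⁻ l∈ in l∈Y
    ; walk         = extend
    }
    where
    2^i≤M : 2 ^ i ≤ M
    2^i≤M = *-cancelˡ-≤ 2 2^≤
    open Level (grow uY ex r∈Y i (≤-trans 2^i≤M (m≤m+n M _)))
    F L′ : List V
    F = neighbours level Y ∖ used
    L′ = take (2 ^ suc i) F
    F⁻ : ∀ {l} → l ∈ F → l ∈ neighbours level Y × l ∉ used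
    F⁻ = ∈-filter⁻ (_∉? used)
    L′⁻ : ∀ {l} → l ∈ L′ → l ∈ Y × ∃[ l₀ ] l₀ ∈ level × H l₀ l
    L′⁻ l∈ = neighbours⁻ {level} {Y} (proj₁ (F⁻ (take-⊆ _ F l∈)))
    enough : 2 ^ suc i ≤ length F
    enough = ≤-by 0 (begin
      3 * 2 ^ i                     ≡⟨ cong (3 *_) level-length ⟨
      3 * length level              ≤⟨ ex level level-unique level-⊆ (subst (_≤ M) (sym level-length) 2^i≤M) ⟩
      length (neighbours level Y)   ≤⟨ length-⊆ (Uniq.filter⁺ _ uY) cover ⟩
      length (F ++ used)            ≡⟨ length-++ F ⟩
      length F + length used        ≤⟨ +-monoʳ-≤ (length F) used-length ⟩
      length F + 2 ^ i              ∎) (arith (2 ^ i) (length F))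
      where
      open ≤-Reasoning
      arith : ∀ a f → 2 * a + (f + a) + 0 ≡ f + 3 * a
      arith = solve-∀
      cover : neighbours level Y ⊆ F ++ used
      cover {v} v∈ with v ∈? used
      ... | yes v∈u = ∈-++⁺ʳ F v∈u
      ... | no  v∉u = ∈-++⁺ˡ (∈-filter⁺ (_∉? used) v∈ v∉u)
    extend : ∀ {l} → l ∈ L′ → ∃[ xs ] Walk H l xs root × Unique xs ×
               length xs ≡ suc (suc i) × xs ⊆ Y × xs ⊆ L′ ++ (level ++ used)
    extend {l} l∈ with l∈Y , l₀ , l₀∈ , h ← L′⁻ l∈ with xs , w , uxs , eq , xs⊆Y , xs⊆ ← walk l₀∈ =
      l ∷ xs , step (H-sym h) w ,
      All.tabulate (λ v∈ l≡v → l∉xs (subst (_∈ xs) (sym l≡v) v∈)) ∷ uxs ,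
      cong suc eq ,
      (λ { (here refl) → l∈Y ; (there v∈) → xs⊆Y v∈ }) ,
      (λ { (here refl) → ∈-++⁺ˡ l∈ ; (there v∈) → ∈-++⁺ʳ L′ (xs⊆ v∈) })
      where
      -- The new level lies on the other side from the previous one.
      l∉xs : l ∉ xs
      l∉xs l∈xs with ∈-++⁻ level (xs⊆ l∈xs)
      ... | inj₁ l∈level = not-¬ (trans (level-side l∈level) (sym (level-side l₀∈))) (proj₂ h)
      ... | inj₂ l∈used  = proj₂ (F⁻ (take-⊆ _ F l∈)) l∈used

  -- The cycle consists of two branches of `suc K` vertices, of `x` and `y`, and of a path of
  -- `suc p` vertices in `Z`. All its edges except `xy` change sides; `parity` says exactly that
  -- going round the remaining `n - 1` edges is consistent.
  join-levels : ∀ {M W} → Joined M W → ∀ {X Y Z x y x₀ y₀ n} K p →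
    Level X x₀ K → X ⊆ W → Level Y y₀ K → Y ⊆ W →
    Unique Z → Z ⊆ W → (∀ b → 6 * M ≤ cnt b Z) →
    Disjoint X Y → Disjoint X Z → Disjoint Y Z →
    x ∉ X → x ∉ Y → x ∉ Z → y ∉ X → y ∉ Y → y ∉ Z → x ≢ y →
    H x₀ x → R x y → H y₀ y → M ≤ 2 ^ K → 2 + p ≤ M →
    n ≡ suc p + (suc K + suc K + 2) → side y ≡ flips (suc n) (side x) →
    ClosedWalk R n
  join-levels {M} {W} joined {X} {Y} {Z} {x} {y} {x₀} {y₀} {n} K p
    levelX X⊆W levelY Y⊆W uZ Z⊆W bigZ X#Y X#Z Y#Z x∉X x∉Y x∉Z y∉X y∉Y y∉Z x≢y
    hx rxy hy M≤2^K p<M n≡ parity = finish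
    where
    module LX = Level levelX
    module LY = Level levelY

    σ τ : Bool
    σ = flips K (side x₀)
    τ = flips K (side y₀)

    -- No edge of `H` joins a vertex to leaves on its own side, so a leaf neighbour is demanded only
    -- of vertices on the opposite side.
    Good : V → Set
    Good z = (side z ≡ σ ⊎ Any (λ l → H l z) LX.level) × (side z ≡ τ ⊎ Any (λ l → H l z) LY.level)

    good? : Decidable Good
    good? z = ((side z ≟ᵇ σ) ⊎-dec any? (λ l → H? l z) LX.level)
        ×-dec ((side z ≟ᵇ τ) ⊎-dec any? (λ l → H? l z) LY.level)

    BX BY Z′ : List V
    BX = isolated joined LX.level (onSide (not σ) Z)
    BY = isolated joined LY.level (onSide (not τ) Z)
    Z′ = filter good? Z

    |BX|≤ : length BX ≤ M
    |BX|≤ = few-isolated joined LX.level-unique (λ l∈ → X⊆W (LX.level-⊆ l∈) , LX.level-side l∈)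
      (subst (M ≤_) (sym LX.level-length) M≤2^K)
      (onSide-unique uZ) (λ v∈ → let v∈Z , sv = onSide⁻ (not σ) Z v∈ in Z⊆W v∈Z , sv)

    |BY|≤ : length BY ≤ M
    |BY|≤ = few-isolated joined LY.level-unique (λ l∈ → Y⊆W (LY.level-⊆ l∈) , LY.level-side l∈)
      (subst (M ≤_) (sym LY.level-length) M≤2^K)
      (onSide-unique uZ) (λ v∈ → let v∈Z , sv = onSide⁻ (not τ) Z v∈ in Z⊆W v∈Z , sv)

    -- 6 = 4 + 1 + 1: the search needs `4 * M`, and each of the two leaf sets excludes at most `M`
    -- vertices.
    bigZ′ : ∀ b → 4 * M ≤ cnt b Z′
    bigZ′ b = ≤-by 0 (begin
      6 * M                                 ≤⟨ bigZ b ⟩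
      cnt b Z                               ≤⟨ length-⊆ (onSide-unique uZ) cover ⟩
      length (onSide b Z′ ++ (BX ++ BY))    ≡⟨ trans (length-++ (onSide b Z′)) (cong (cnt b Z′ +_) (length-++ BX)) ⟩
      cnt b Z′ + (length BX + length BY)    ≤⟨ +-monoʳ-≤ (cnt b Z′) (+-mono-≤ |BX|≤ |BY|≤) ⟩
      cnt b Z′ + (M + M)                    ∎) (arith M (cnt b Z′))
      where
      open ≤-Reasoning
      arith : ∀ m c → 4 * m + (c + (m + m)) + 0 ≡ c + 6 * m
      arith = solve-∀
      stuck : ∀ {v ρ} L → v ∈ Z → ¬ (side v ≡ ρ ⊎ Any (λ l → H l v) L) → v ∈ isolated joined L (onSide (not ρ) Z)
      stuck L v∈Z bad = ∈-filter⁺ (λ z → ¬? (any? (λ l → H? l z) L))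
        (onSide⁺ v∈Z (¬-not (bad ∘ inj₁))) (bad ∘ inj₂)
      cover : onSide b Z ⊆ onSide b Z′ ++ (BX ++ BY)
      cover {v} v∈ with v∈Z , sv ← onSide⁻ b Z v∈
        with (side v ≟ᵇ σ) ⊎-dec any? (λ l → H? l v) LX.level
           | (side v ≟ᵇ τ) ⊎-dec any? (λ l → H? l v) LY.level
      ... | yes gx | yes gy = ∈-++⁺ˡ (onSide⁺ (∈-filter⁺ good? v∈Z (gx , gy)) sv)
      ... | no bad | _      = ∈-++⁺ʳ (onSide b Z′) (∈-++⁺ˡ (stuck LX.level v∈Z bad))
      ... | yes _  | no bad = ∈-++⁺ʳ (onSide b Z′) (∈-++⁺ʳ BX (stuck LY.level v∈Z bad))

    -- A path that starts opposite to the leaves in `Y` ends opposite to those in `X`: the total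
    -- number of side changes is `K + 2` up to an even number.
    end-side : ∀ {v} → side v ≡ flips p (not τ) → side v ≡ not σ
    end-side {v} sv = trans sv (begin
      flips p (not (flips K (side y₀)))
        ≡⟨ cong (λ b → flips p (not (flips K b))) (trans (proj₂ (H-sym hy)) (cong not parity)) ⟩
      flips p (flips 1 (flips K (flips (2 + n) (side x))))
        ≡⟨ cong (λ b → flips p (flips 1 b)) (flips-+ K (2 + n) (side x)) ⟩
      flips p (flips (1 + (K + (2 + n))) (side x))
        ≡⟨ flips-+ p (1 + (K + (2 + n))) (side x) ⟩
      flips (p + (1 + (K + (2 + n)))) (side x)
        ≡⟨ cong (λ j → flips j (side x)) (trans (cong (λ j → p + (1 + (K + (2 + j)))) n≡) (arith p K)) ⟩
      flips ((p + K + 3) + (p + K + 3) + (1 + (K + 1))) (side x)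
        ≡⟨ flips-+ ((p + K + 3) + (p + K + 3)) (1 + (K + 1)) (side x) ⟨
      flips ((p + K + 3) + (p + K + 3)) (flips (1 + (K + 1)) (side x))
        ≡⟨ flips-double (p + K + 3) (flips (1 + (K + 1)) (side x)) ⟩
      flips (1 + (K + 1)) (side x)
        ≡⟨ cong not (flips-+ K 1 (side x)) ⟨
      not (flips K (not (side x)))
        ≡⟨ cong (λ b → not (flips K b)) (proj₂ (H-sym hx)) ⟨
      not σ ∎)
      where
      open ≡-Reasoning
      arith : ∀ p k → p + (1 + (k + (2 + (suc p + (suc k + suc k + 2))))) ≡ (p + k + 3) + (p + k + 3) + (1 + (k + 1))
      arith = solve-∀

    reachX : ∀ {z} → z ∈ Z′ → side z ≡ not σ → Any (λ l → H l z) LX.level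
    reachX z∈ sz with proj₁ (proj₂ (∈-filter⁻ good? {xs = Z} z∈))
    ... | inj₁ sz′ = ⊥-elim (not-¬ sz′ sz)
    ... | inj₂ nz  = nz

    reachY : ∀ {z} → z ∈ Z′ → side z ≡ not τ → Any (λ l → H l z) LY.level
    reachY z∈ sz with proj₂ (proj₂ (∈-filter⁻ good? {xs = Z} z∈))
    ... | inj₁ sz′ = ⊥-elim (not-¬ sz′ sz)
    ... | inj₂ nz  = nz

    arith : ∀ k p → suc k + (2 + (suc k + suc p)) ≡ suc p + (suc k + suc k + 2)
    arith = solve-∀

    finish : ClosedWalk R n
    finish =
      -- The search is asked for `2 + p` vertices, one more than the path has; `trim` spends it on
      -- the starting side.
      let _ , _ , _ , w , |w| , uw , w⊆Z′ = dfs-bipartite joined (suc p) Z′ p<M (Uniq.filter⁺ _ uZ)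
                                              (Z⊆W ∘ proj₁ ∘ ∈-filter⁻ good? {xs = Z}) bigZ′
          u , v , zs , wz , |zs| , uzs , zs⊆ , su = trim (not τ) w |w| uw
          sv = end-side (trans (walk-side wz |zs|) (cong (flips p) su))
          lY , lY∈ , hlY = find (reachY (w⊆Z′ (zs⊆ (walk-start∈ wz))) su)
          lX , lX∈ , hlX = find (reachX (w⊆Z′ (zs⊆ (walk-end∈ wz))) sv)
          ps , wp , up , |ps| , ps⊆X , _ = LX.walk lX∈
          rs , wr , ur , |rs| , rs⊆Y , _ = LY.walk lY∈
      in subst (ClosedWalk R)
        (trans (cong₂ (λ i j → i + (2 + j)) |ps| (cong₂ _+_ |rs| |zs|)) (trans (arith K p) (sym n≡)))
        (splice R-sym X#Y X#Z Y#Z x∉X x∉Y x∉Z y∉X y∉Y y∉Z x≢y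
          (walk-map proj₁ wp) up ps⊆X (proj₁ hx) rxy (R-sym (proj₁ hy))
          (walk-map proj₁ wr) ur rs⊆Y (proj₁ hlY)
          (walk-map proj₁ wz) uzs (proj₁ ∘ ∈-filter⁻ good? {xs = Z} ∘ w⊆Z′ ∘ zs⊆) (R-sym (proj₁ hlX)))

-- Partition of the two sides into regions

module _ {A : Set} where

  split-at : ∀ k {r} (xs : List A) → k + r ≤ length xs →
    ∃₂ λ ys zs → xs ≡ ys ++ zs × length ys ≡ k × r ≤ length zs
  split-at k {r} xs k+r≤ = take k xs , drop k xs , sym (take++drop≡id k xs) ,
    length-take-≤ xs (m+n≤o⇒m≤o k k+r≤) ,
    subst (r ≤_) (sym (length-drop k xs)) (m+n≤o⇒m≤o∸n r (subst (_≤ length xs) (+-comm k r) k+r≤))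

  -- `X` and `Y` will hold the two trees and have the size required by `clean-bipartite`, `Z` will
  -- hold the connecting path, and `E` the edge `xy`. The three regions take `32 * M` vertices.
  record Split (M a : ℕ) (xs : List A) : Set where
    field
      {X Y Z E} : List A
      xs≡  : xs ≡ X ++ (Y ++ (Z ++ E))
      |X|≡ : length X ≡ 13 * M
      |Y|≡ : length Y ≡ 13 * M
      |Z|≡ : length Z ≡ 6 * M
      a≤   : a ≤ length E

  split : ∀ M a xs → 32 * M + a ≤ length xs → Split M a xs
  split M a xs big =
    let X , ys , xs≡ , |X| , ys≥ = split-at (13 * M) xs (subst (_≤ length xs) (arith M a) big)
        Y , zs , ys≡ , |Y| , zs≥ = split-at (13 * M) ys ys≥
        Z , E , zs≡ , |Z| , E≥ = split-at (6 * M) zs zs≥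
    in record
      { X = X ; Y = Y ; Z = Z ; E = E
      ; xs≡ = trans xs≡ (cong (X ++_) (trans ys≡ (cong (Y ++_) zs≡)))
      ; |X|≡ = |X| ; |Y|≡ = |Y| ; |Z|≡ = |Z| ; a≤ = E≥ }
    where
    arith : ∀ m a → 32 * m + a ≡ 13 * m + (13 * m + (6 * m + a))
    arith = solve-∀

module TwoSided {V : Set} (_≟_ : DecidableEquality V) {R : V → V → Set} (R? : Decidable₂ R)
                (R-sym : Symmetric R) {A B : List V} (uA : Unique A) (uB : Unique B) (A#B : Disjoint A B) where

  open DecMembership _≟_ using (_∈?_)

  -- Vertices outside both sets also get `false`; `Joined` is confined to `W`, where `false` means
  -- `B`.
  side : V → Bool
  side v = does (v ∈? A)

  side-A : ∀ {v} → v ∈ A → side v ≡ true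
  side-A {v} = dec-true (v ∈? A)

  side-B : ∀ {v} → v ∈ B → side v ≡ false
  side-B {v} v∈B = dec-false (v ∈? A) (λ v∈A → A#B (v∈A , v∈B))

  open Bipartite _≟_ R? R-sym side
  open BipartiteCycle _≟_ R? R-sym side

  W : List V
  W = A ++ B

  true-A : ∀ {v} → v ∈ W → side v ≡ true → v ∈ A
  true-A v∈ sv with ∈-++⁻ A v∈
  ... | inj₁ v∈A = v∈A
  ... | inj₂ v∈B = case trans (sym sv) (side-B v∈B) of λ ()

  false-B : ∀ {v} → v ∈ W → side v ≡ false → v ∈ B
  false-B v∈ sv with ∈-++⁻ A v∈
  ... | inj₁ v∈A = case trans (sym sv) (side-A v∈A) of λ ()
  ... | inj₂ v∈B = v∈B

  Crossing : ℕ → Set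
  Crossing M = ∀ S T → Unique S → Unique T → S ⊆ A → T ⊆ B → M ≤ length S → M ≤ length T →
    ∃₂ λ s t → s ∈ S × t ∈ T × R s t

  crossing⇒joined : ∀ {M} → Crossing M → Joined M W
  crossing⇒joined cr true  S T uS uT S⊆ T⊆ M≤S M≤T =
    cr S T uS uT (λ v∈ → true-A (proj₁ (S⊆ v∈)) (proj₂ (S⊆ v∈)))
                 (λ v∈ → false-B (proj₁ (T⊆ v∈)) (proj₂ (T⊆ v∈))) M≤S M≤T
  crossing⇒joined cr false S T uS uT S⊆ T⊆ M≤S M≤T
    with t , s , t∈ , s∈ , r ← cr T S uT uS
           (λ v∈ → true-A (proj₁ (T⊆ v∈)) (proj₂ (T⊆ v∈)))
           (λ v∈ → false-B (proj₁ (S⊆ v∈)) (proj₂ (S⊆ v∈))) M≤T M≤S = s , t , s∈ , t∈ , R-sym r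

  cnt-++ : ∀ {k P Q} → Unique P → Unique Q → P ⊆ A → Q ⊆ B → length P ≡ k → length Q ≡ k → ∀ b → k ≤ cnt b (P ++ Q)
  cnt-++         uP uQ P⊆ Q⊆ |P| |Q| true  =
    subst (_≤ _) |P| (length-⊆ uP (λ v∈ → onSide⁺ (∈-++⁺ˡ v∈) (side-A (P⊆ v∈))))
  cnt-++ {P = P} uP uQ P⊆ Q⊆ |P| |Q| false =
    subst (_≤ _) |Q| (length-⊆ uQ (λ v∈ → onSide⁺ (∈-++⁺ʳ P v∈) (side-B (Q⊆ v∈))))

  -- Ends may be taken anywhere in `E ++ F`, so that edges inside `A` (odd `n`) and edges across
  -- (even `n`) are both covered. The loss of at most `2 * M` vertices per side is written
  -- additively, without subtraction.
  Linked : ℕ → ℕ → ℕ → ℕ → Set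
  Linked M a b n = ∃₂ λ E F → Unique E × Unique F × E ⊆ A × F ⊆ B × a ≤ length E + 2 * M × b ≤ length F + 2 * M ×
      (∀ {x y} → x ∈ E ++ F → y ∈ E ++ F → x ≢ y → R x y → side y ≡ flips (suc n) (side x) → ClosedWalk R n)
  -- The cleaned regions keep `M` vertices on each side, so on each side of the remainder at most
  -- `M` vertices lack a neighbour in the first region and at most `M` in the second. Every other
  -- vertex can be attached to a tree in either region.
  linked : ∀ {M a b n} K p → 0 < M → Crossing M → 32 * M + a ≤ length A → 32 * M + b ≤ length B →
    M ≤ 2 ^ K → 2 ^ K ≤ 2 * M → 2 + p ≤ M → n ≡ suc p + (suc K + suc K + 2) →
    ¬ ¬ Linked M a b n
  linked {M} {a} {b} {n} K p 0<M crossing A≥ B≥ M≤2^K 2^K≤2M p<M n≡ κ =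
    clean-bipartite joined X 0<M uX X⊆W (cnt-++ SA.uX SB.uX SA.X⊆ SB.X⊆ SA.|X|≡ SB.|X|≡)
      λ (X′ , uX′ , X′⊆ , exX , bigX) →
    clean-bipartite joined Y 0<M uY Y⊆W (cnt-++ SA.uY SB.uY SA.Y⊆ SB.Y⊆ SA.|Y|≡ SB.|Y|≡)
      λ (Y′ , uY′ , Y′⊆ , exY , bigY) →
    let open Trees X′ uX′ X′⊆ exX bigX Y′ uY′ Y′⊆ exY bigY in
    κ (keep SA.E , keep SB.E , Uniq.filter⁺ good? SA.uE , Uniq.filter⁺ good? SB.uE ,
       SA.E⊆ ∘ proj₁ ∘ keep⁻ , SB.E⊆ ∘ proj₁ ∘ keep⁻ ,
       ≤-trans SA.a≤ (few-lost true SA.uE (λ v∈ → ∈-++⁺ˡ (SA.E⊆ v∈) , side-A (SA.E⊆ v∈))) ,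
       ≤-trans SB.a≤ (few-lost false SB.uE (λ v∈ → ∈-++⁺ʳ A (SB.E⊆ v∈) , side-B (SB.E⊆ v∈))) ,
       cycle)
    where
    joined : Joined M W
    joined = crossing⇒joined crossing

    module Pieces {k xs} (uxs : Unique xs) (s : Split {V} M k xs) where
      open Split s public
      u : Unique (X ++ (Y ++ (Z ++ E)))
      u = subst Unique xs≡ uxs
      in-xs : X ++ (Y ++ (Z ++ E)) ⊆ xs
      in-xs = subst (_ ∈_) (sym xs≡)
      uX = unique-++ˡ X u
      uY = unique-++ˡ Y (unique-++ʳ X u)
      uZ = unique-++ˡ Z (unique-++ʳ Y (unique-++ʳ X u))
      uE = unique-++ʳ Z (unique-++ʳ Y (unique-++ʳ X u))
      X⊆ : X ⊆ xs
      X⊆ = in-xs ∘ ∈-++⁺ˡ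
      Y⊆ : Y ⊆ xs
      Y⊆ = in-xs ∘ ∈-++⁺ʳ X ∘ ∈-++⁺ˡ
      Z⊆ : Z ⊆ xs
      Z⊆ = in-xs ∘ ∈-++⁺ʳ X ∘ ∈-++⁺ʳ Y ∘ ∈-++⁺ˡ
      E⊆ : E ⊆ xs
      E⊆ = in-xs ∘ ∈-++⁺ʳ X ∘ ∈-++⁺ʳ Y ∘ ∈-++⁺ʳ Z
      X#Y : Disjoint X Y
      X#Y (p , q) = unique-++-disjoint X u (p , ∈-++⁺ˡ q)
      X#Z : Disjoint X Z
      X#Z (p , q) = unique-++-disjoint X u (p , ∈-++⁺ʳ Y (∈-++⁺ˡ q))
      X#E : Disjoint X E
      X#E (p , q) = unique-++-disjoint X u (p , ∈-++⁺ʳ Y (∈-++⁺ʳ Z q))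
      Y#Z : Disjoint Y Z
      Y#Z (p , q) = unique-++-disjoint Y (unique-++ʳ X u) (p , ∈-++⁺ˡ q)
      Y#E : Disjoint Y E
      Y#E (p , q) = unique-++-disjoint Y (unique-++ʳ X u) (p , ∈-++⁺ʳ Z q)
      Z#E : Disjoint Z E
      Z#E = unique-++-disjoint Z (unique-++ʳ Y (unique-++ʳ X u))

    module SA = Pieces uA (split M a A A≥)
    module SB = Pieces uB (split M b B B≥)

    X Y Z : List V
    X = SA.X ++ SB.X
    Y = SA.Y ++ SB.Y
    Z = SA.Z ++ SB.Z

    module _ {P Q : List V} (P⊆ : P ⊆ A) (Q⊆ : Q ⊆ B) where
      cross-⊆ : P ++ Q ⊆ W
      cross-⊆ v∈ with ∈-++⁻ P v∈
      ... | inj₁ v∈P = ∈-++⁺ˡ (P⊆ v∈P)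
      ... | inj₂ v∈Q = ∈-++⁺ʳ A (Q⊆ v∈Q)
      cross-unique : Unique P → Unique Q → Unique (P ++ Q)
      cross-unique uP uQ = Uniq.++⁺ uP uQ (λ (v∈P , v∈Q) → A#B (P⊆ v∈P , Q⊆ v∈Q))
      cross-disjoint : ∀ {P′ Q′} → P′ ⊆ A → Q′ ⊆ B → Disjoint P P′ → Disjoint Q Q′ → Disjoint (P ++ Q) (P′ ++ Q′)
      cross-disjoint {P′} P′⊆ Q′⊆ P#P′ Q#Q′ (v∈ , v∈′) with ∈-++⁻ P v∈ | ∈-++⁻ P′ v∈′
      ... | inj₁ p | inj₁ p′ = P#P′ (p , p′)
      ... | inj₁ p | inj₂ q′ = A#B (P⊆ p , Q′⊆ q′)
      ... | inj₂ q | inj₁ p′ = A#B (P′⊆ p′ , Q⊆ q)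
      ... | inj₂ q | inj₂ q′ = Q#Q′ (q , q′)

    uX = cross-unique SA.X⊆ SB.X⊆ SA.uX SB.uX
    uY = cross-unique SA.Y⊆ SB.Y⊆ SA.uY SB.uY
    uZ = cross-unique SA.Z⊆ SB.Z⊆ SA.uZ SB.uZ
    X⊆W = cross-⊆ SA.X⊆ SB.X⊆
    Y⊆W = cross-⊆ SA.Y⊆ SB.Y⊆
    Z⊆W = cross-⊆ SA.Z⊆ SB.Z⊆
    X#E = cross-disjoint SA.X⊆ SB.X⊆ SA.E⊆ SB.E⊆ SA.X#E SB.X#E
    Y#E = cross-disjoint SA.Y⊆ SB.Y⊆ SA.E⊆ SB.E⊆ SA.Y#E SB.Y#E
    Z#E = cross-disjoint SA.Z⊆ SB.Z⊆ SA.E⊆ SB.E⊆ SA.Z#E SB.Z#E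
    X#Y = cross-disjoint SA.X⊆ SB.X⊆ SA.Y⊆ SB.Y⊆ SA.X#Y SB.X#Y
    X#Z = cross-disjoint SA.X⊆ SB.X⊆ SA.Z⊆ SB.Z⊆ SA.X#Z SB.X#Z
    Y#Z = cross-disjoint SA.Y⊆ SB.Y⊆ SA.Z⊆ SB.Z⊆ SA.Y#Z SB.Y#Z

    module Trees (X′ : List V) (uX′ : Unique X′) (X′⊆ : X′ ⊆ X) (exX : Expanding M X′) (bigX : ∀ b → M ≤ cnt b X′)
                 (Y′ : List V) (uY′ : Unique Y′) (Y′⊆ : Y′ ⊆ Y) (exY : Expanding M Y′) (bigY : ∀ b → M ≤ cnt b Y′) where
      -- Both conditions are imposed on every vertex because it may serve as `x` or as `y`.
      Good : V → Set
      Good e = Any (λ v → H v e) X′ × Any (λ v → H v e) Y′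
      good? : Decidable Good
      good? e = any? (λ v → H? v e) X′ ×-dec any? (λ v → H? v e) Y′
      keep : List V → List V
      keep = filter good?
      keep⁻ : ∀ {E v} → v ∈ keep E → v ∈ E × Good v
      keep⁻ = ∈-filter⁻ good?

      few-lost : ∀ b {E} → Unique E → W ⟨ b ⟩⊇ E → length E ≤ length (keep E) + 2 * M
      few-lost b {E} uE E⊆ = begin
        length E
          ≤⟨ length-⊆ uE cover ⟩
        length (keep E ++ (lost X′ ++ lost Y′))
          ≡⟨ trans (length-++ (keep E)) (cong (length (keep E) +_) (length-++ (lost X′))) ⟩
        length (keep E) + (length (lost X′) + length (lost Y′))
          ≤⟨ +-monoʳ-≤ (length (keep E)) (+-mono-≤
            (lost≤ uX′ (X⊆W ∘ X′⊆) (bigX (not b))) (≤-trans (lost≤ uY′ (Y⊆W ∘ Y′⊆) (bigY (not b))) (m≤m+n M 0))) ⟩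
        length (keep E) + 2 * M ∎
        where
        open ≤-Reasoning
        lost : List V → List V
        lost L = isolated joined (onSide (not b) L) E
        lost≤ : ∀ {L} → Unique L → L ⊆ W → M ≤ cnt (not b) L → length (lost L) ≤ M
        lost≤ {L} uL L⊆ big = few-isolated joined (onSide-unique uL)
          (λ v∈ → let v∈L , sv = onSide⁻ (not b) L v∈ in L⊆ v∈L , sv) big uE
          (λ v∈ → let v∈W , sv = E⊆ v∈ in v∈W , trans sv (sym (not-involutive b)))
        isLost : ∀ {v} L → v ∈ E → ¬ Any (λ l → H l v) L → v ∈ lost L
        isLost L v∈E none = ∈-filter⁺ (λ z → ¬? (any? (λ l → H? l z) (onSide (not b) L))) v∈E
          (λ some → let l , l∈ , h = find some in none (lose (proj₁ (onSide⁻ (not b) L l∈)) h))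
        cover : E ⊆ keep E ++ (lost X′ ++ lost Y′)
        cover {v} v∈ with any? (λ l → H? l v) X′ | any? (λ l → H? l v) Y′
        ... | yes gx | yes gy = ∈-++⁺ˡ (∈-filter⁺ good? v∈ (gx , gy))
        ... | no ng  | _      = ∈-++⁺ʳ (keep E) (∈-++⁺ˡ (isLost X′ v∈ ng))
        ... | yes _  | no ng  = ∈-++⁺ʳ (keep E) (∈-++⁺ʳ (lost X′) (isLost Y′ v∈ ng))

      both⁻ : ∀ {v} → v ∈ keep SA.E ++ keep SB.E → v ∈ SA.E ++ SB.E × Good v
      both⁻ v∈ with ∈-++⁻ (keep SA.E) v∈
      ... | inj₁ v∈A = let v∈E , g = keep⁻ {SA.E} v∈A in ∈-++⁺ˡ v∈E , g
      ... | inj₂ v∈B = let v∈E , g = keep⁻ {SB.E} v∈B in ∈-++⁺ʳ SA.E v∈E , g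

      cycle : ∀ {x y} → x ∈ keep SA.E ++ keep SB.E → y ∈ keep SA.E ++ keep SB.E → x ≢ y → R x y →
        side y ≡ flips (suc n) (side x) → ClosedWalk R n
      cycle x∈ y∈ x≢y r par =
        let x∈E , gx , _ = both⁻ x∈
            y∈E , _ , gy = both⁻ y∈
            x₀ , x₀∈ , hx = find gx
            y₀ , y₀∈ , hy = find gy
        in join-levels joined K p
             (grow uX′ exX x₀∈ K 2^K≤2M) (X⊆W ∘ X′⊆) (grow uY′ exY y₀∈ K 2^K≤2M) (Y⊆W ∘ Y′⊆)
             uZ Z⊆W (cnt-++ SA.uZ SB.uZ SA.Z⊆ SB.Z⊆ SA.|Z|≡ SB.|Z|≡)
             (λ (u , v) → X#Y (X′⊆ u , Y′⊆ v)) (λ (u , v) → X#Z (X′⊆ u , v)) (λ (u , v) → Y#Z (Y′⊆ u , v))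
             (λ v → X#E (X′⊆ v , x∈E)) (λ v → Y#E (Y′⊆ v , x∈E)) (λ v → Z#E (v , x∈E))
             (λ v → X#E (X′⊆ v , y∈E)) (λ v → Y#E (Y′⊆ v , y∈E)) (λ v → Z#E (v , y∈E))
             x≢y hx r hy M≤2^K p<M n≡ par

-- Eliminating the colours

power-of-2-above : ∀ M → 0 < M → ∃[ K ] M ≤ 2 ^ K × 2 ^ K ≤ 2 * M
power-of-2-above 1 _ = 0 , ≤-refl , s≤s z≤n
power-of-2-above (suc (suc M)) _ with K , M≤ , ≤2M ← power-of-2-above (suc M) z<s
  with suc (suc M) ≤? 2 ^ K
... | yes M<2^K = K , M<2^K , ≤-trans ≤2M (*-monoʳ-≤ 2 (n≤1+n (suc M)))
... | no  M≮2^K = suc K ,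
  ≤-trans (≤-trans (+-monoʳ-≤ 1 M≤) (+-monoˡ-≤ (2 ^ K) (m^n>0 2 K))) (+-monoʳ-≤ (2 ^ K) (m≤m+n (2 ^ K) 0)) ,
  *-monoʳ-≤ 2 (<⇒≤ (≰⇒> M≮2^K))

-- From `2 ^ (2 + K) ≤ 8 * M ≤ 2 ^ ℓ` follows `2 + K ≤ ℓ`. Hence `n` has room for two branches of
-- `suc K` vertices, for `x` and `y`, and for a nonempty path; `p` is the excess.
cycle-shape : ∀ {M n ℓ m} → 0 < M → 8 * M ≤ 2 ^ ℓ → m ≤ M → n ≤ m → 2 * suc ℓ ≤ n →
  ∃₂ λ K p → M ≤ 2 ^ K × 2 ^ K ≤ 2 * M × 2 + p ≤ M × n ≡ suc p + (suc K + suc K + 2)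
cycle-shape {M} {n} {ℓ} {m} 0<M 8M≤ m≤M n≤m ℓ≤n with K , M≤ , ≤2M ← power-of-2-above M 0<M =
  K , p , M≤ , ≤2M ,
  ≤-trans (≤-by {p = 0} (K + K + 3) z≤n
    (trans (arith₂ p K) (trans (sym n≡) (sym (+-identityʳ n))))) (≤-trans n≤m m≤M) ,
  n≡
  where
  2+K≤ℓ : 2 + K ≤ ℓ
  2+K≤ℓ = ≮⇒≥ λ ℓ<2+K → <-irrefl refl (begin-strict
    2 ^ ℓ          <⟨ ^-monoʳ-< 2 (s≤s (s≤s z≤n)) ℓ<2+K ⟩
    2 * (2 * 2 ^ K) ≤⟨ *-monoʳ-≤ 2 (*-monoʳ-≤ 2 ≤2M) ⟩
    2 * (2 * (2 * M)) ≡⟨ arith₁ M ⟩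
    8 * M          ≤⟨ 8M≤ ⟩
    2 ^ ℓ          ∎)
    where
    open ≤-Reasoning
    arith₁ : ∀ m → 2 * (2 * (2 * m)) ≡ 8 * m
    arith₁ = solve-∀
  arith₂ : ∀ p k → 2 + p + 0 + (k + k + 3) ≡ suc p + (suc k + suc k + 2)
  arith₂ = solve-∀
  5+2K≤n : 1 + (suc K + suc K + 2) ≤ n
  5+2K≤n = ≤-trans (≤-by {p = 2 * (2 + K)} 1 (*-monoʳ-≤ 2 2+K≤ℓ) (arith₃ K ℓ)) ℓ≤n
    where
    arith₃ : ∀ k l → 1 + (suc k + suc k + 2) + 2 * l + 1 ≡ 2 * suc l + 2 * (2 + k)
    arith₃ = solve-∀
  p : ℕ
  p = n ∸ (1 + (suc K + suc K + 2))
  n≡ : n ≡ suc p + (suc K + suc K + 2)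
  n≡ = trans (sym (m∸n+n≡m 5+2K≤n)) (+-suc p _)

-- With `c` the factor of the earlier colours, each side of the outer hole has `(34 + c) * M`
-- vertices: `32 * M` for the regions, `2 * M` for discarded vertices and `c * M` for the inner
-- hole. The initial 2 splits a set into two.
hole-factor : ℕ → ℕ
hole-factor zero    = 2
hole-factor (suc k) = hole-factor k * (34 + hole-factor k)

module Coloured {V C : Set} (_≟_ : DecidableEquality V) (_≟ᶜ_ : DecidableEquality C)
                (col : V → V → C) (col-sym : ∀ u v → col u v ≡ col v u) where

  Col : C → V → V → Set
  Col i u v = col u v ≡ i

  Col? : ∀ i → Decidable₂ (Col i)
  Col? i u v = col u v ≟ᶜ i

  Col-sym : ∀ i → Symmetric (Col i)
  Col-sym i {u} {v} e = trans (col-sym v u) e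

  Admissible : ℕ → ℕ → C × ℕ → Set
  Admissible ℓ m (i , n) = n ≤ m × 2 * suc ℓ ≤ n × ¬ ClosedWalk (Col i) n

  -- `A` and `B` coincide in the case of odd colours, so the disjointness of `S` and `T` is recorded
  -- separately.
  record Hole (is : List (C × ℕ)) (M : ℕ) (A B : List V) : Set where
    field
      {S T} : List V
      uS    : Unique S
      uT    : Unique T
      S⊆    : S ⊆ A
      T⊆    : T ⊆ B
      S#T   : Disjoint S T
      M≤S   : M ≤ length S
      M≤T   : M ≤ length T
      free  : ∀ {s t} → s ∈ S → t ∈ T → All (λ (i , _) → col s t ≢ i) is

  edge? : ∀ i S T → Dec (∃₂ λ s t → s ∈ S × t ∈ T × Col i s t)
  edge? i S T with any? (λ s → any? (Col? i s) T) S
  ... | yes e = let s , s∈ , e′ = find e ; t , t∈ , r = find e′ in yes (s , t , s∈ , t∈ , r)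
  ... | no ¬e = no λ (s , t , s∈ , t∈ , r) → ¬e (lose s∈ (lose t∈ r))

  Odd Even : C × ℕ → Set
  Odd  (_ , n) = ∃[ h ] n ≡ suc (h + h)
  Even (_ , n) = ∃[ h ] n ≡ h + h

  -- By `κ`, every hole of the earlier colours of size `M` is crossed by an edge of colour `i`.
  -- Inside a large outer hole this makes colour `i` joined; a second hole, found inside the side
  -- `A` of the first, then supplies an edge closing an odd cycle.
  odd-hole : ∀ {ℓ m} is → All (Admissible ℓ m) is → All Odd is →
    ∀ {M} → 0 < M → m ≤ M → ∀ W → Unique W →
    hole-factor (length is) * M ≤ length W → length W ≤ 2 ^ ℓ →
    ¬ ¬ Hole is M W W
  odd-hole [] _ _ {M} 0<M m≤M W uW big _ κ =
    let S , T , W≡ , |S| , M≤T = split-at M W (subst (_≤ length W) (cong (M +_) (+-identityʳ M)) big)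
        u = subst Unique W≡ uW
    in κ (record
      { S = S ; T = T ; uS = unique-++ˡ S u ; uT = unique-++ʳ S u
      ; S⊆ = subst (_ ∈_) (sym W≡) ∘ ∈-++⁺ˡ ; T⊆ = subst (_ ∈_) (sym W≡) ∘ ∈-++⁺ʳ S
      ; S#T = unique-++-disjoint S u ; M≤S = ≤-reflexive (sym |S|) ; M≤T = M≤T ; free = λ _ _ → [] })
  odd-hole {ℓ} {m} ((i , n) ∷ is) ((n≤m , ℓ≤n , ¬cycle) ∷ adm) ((h , n≡) ∷ odd) {M} 0<M m≤M W uW big small κ =
    odd-hole is adm odd (≤-trans 0<M M≤M′) (≤-trans m≤M M≤M′) W uW
      (subst (_≤ length W) (*-assoc c (34 + c) M) big) small outer
    where
    c M′ : ℕ
    c  = hole-factor (length is)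
    M′ = (34 + c) * M
    M≤M′ : M ≤ M′
    M≤M′ = m≤m+n M ((33 + c) * M)

    extend : ∀ {A B} (H : Hole is M A B) → A ⊆ W → B ⊆ W →
      ¬ (∃₂ λ s t → s ∈ Hole.S H × t ∈ Hole.T H × Col i s t) → ⊥
    extend H A⊆ B⊆ none = κ (record
      { uS = uS ; uT = uT ; S⊆ = A⊆ ∘ S⊆ ; T⊆ = B⊆ ∘ T⊆ ; S#T = S#T ; M≤S = M≤S ; M≤T = M≤T
      ; free = λ s∈ t∈ → (λ e → none (_ , _ , s∈ , t∈ , e)) ∷ free s∈ t∈ })
      where open Hole H

    outer : Hole is M′ W W → ⊥
    outer H = let K , p , M≤2^K , 2^K≤2M , p<M , n≡′ = cycle-shape 0<M 8M≤ m≤M n≤m ℓ≤n in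
      linked K p 0<M crossing big-A big-B M≤2^K 2^K≤2M p<M n≡′ inner
      where
      open Hole H renaming (S to A; T to B)
      open TwoSided _≟_ (Col? i) (Col-sym i) uS uT S#T using (Crossing; Linked; linked; side-A; side-B)

      8M≤ : 8 * M ≤ 2 ^ ℓ
      8M≤ = begin
        8 * M          ≤⟨ *-monoˡ-≤ M (m≤m+n 8 (26 + c)) ⟩
        (34 + c) * M   ≤⟨ M≤S ⟩
        length A       ≤⟨ length-⊆ uS S⊆ ⟩
        length W       ≤⟨ small ⟩
        2 ^ ℓ          ∎
        where open ≤-Reasoning

      big-A : 32 * M + (2 + c) * M ≤ length A
      big-A = subst (_≤ length A) (*-distribʳ-+ M 32 (2 + c)) M≤S

      -- `B` contributes only the three regions, since the edge `xy` will lie inside `A`.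
      big-B : 32 * M + 0 ≤ length B
      big-B = ≤-trans (≤-reflexive (+-identityʳ (32 * M))) (≤-trans (*-monoˡ-≤ M (m≤m+n 32 (2 + c))) M≤T)

      crossing : Crossing M
      crossing S T uS′ uT′ S⊆′ T⊆′ M≤S′ M≤T′ with edge? i S T
      ... | yes e = e
      ... | no ¬e = ⊥-elim (extend {A} {B} (record
        { uS = uS′ ; uT = uT′ ; S⊆ = S⊆′ ; T⊆ = T⊆′ ; S#T = λ (s∈ , t∈) → S#T (S⊆′ s∈ , T⊆′ t∈)
        ; M≤S = M≤S′ ; M≤T = M≤T′ ; free = λ s∈ t∈ → free (S⊆′ s∈) (T⊆′ t∈) }) S⊆ T⊆ ¬e)

      -- `n` is odd, so the ends of the edge must lie on the same side.
      parity : flips (suc n) true ≡ true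
      parity = trans (cong (λ j → flips j true) (trans (cong suc n≡) (sym (cong suc (+-suc h h)))))
        (flips-double (suc h) true)

      inner : Linked M ((2 + c) * M) 0 n → ⊥
      inner (E , F , uE , _ , E⊆ , _ , big-E , _ , cycle) =
        odd-hole is adm odd 0<M m≤M E uE
          (+-cancelˡ-≤ (2 * M) _ _ (≤-trans (≤-reflexive (sym (*-distribʳ-+ M 2 c)))
            (≤-trans big-E (≤-reflexive (+-comm (length E) (2 * M))))))
          (≤-trans (length-⊆ uE (S⊆ ∘ E⊆)) small)
          λ H′ → extend H′ (S⊆ ∘ E⊆) (S⊆ ∘ E⊆) λ (s , t , s∈ , t∈ , e) →
            let s∈E = Hole.S⊆ H′ s∈ ; t∈E = Hole.T⊆ H′ t∈ in
            ¬cycle (cycle (∈-++⁺ˡ s∈E) (∈-++⁺ˡ t∈E)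
              (λ s≡t → Hole.S#T H′ (s∈ , subst (_∈ _) (sym s≡t) t∈)) e
              (trans (side-A (E⊆ t∈E)) (sym (trans (cong (flips (suc n)) (side-A (E⊆ s∈E))) parity))))

  -- One call of the induction hypothesis suffices: colour `i` is joined in the hole it returns, and
  -- a crossing edge has the parity of an even cycle. The new hole stays within `A` and `B`, so it
  -- remains free of the odd colours.
  even-hole : ∀ {ℓ m} is → All (Admissible ℓ m) is → All Even is →
    ∀ {M} → 0 < M → m ≤ M → ∀ A B → Unique A → Unique B → Disjoint A B →
    81 ^ length is * M ≤ length A → 81 ^ length is * M ≤ length B → length A ≤ 2 ^ ℓ →
    ¬ ¬ Hole is M A B
  even-hole [] _ _ {M} 0<M m≤M A B uA uB A#B big-A big-B _ κ = κ (record
    { S = A ; T = B ; uS = uA ; uT = uB ; S⊆ = id ; T⊆ = id ; S#T = A#B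
    ; M≤S = ≤-trans (≤-reflexive (sym (*-identityˡ M))) big-A
    ; M≤T = ≤-trans (≤-reflexive (sym (*-identityˡ M))) big-B ; free = λ _ _ → [] })
  even-hole {ℓ} {m} ((i , n) ∷ is) ((n≤m , ℓ≤n , ¬cycle) ∷ adm) ((h , n≡) ∷ even) {M} 0<M m≤M
    A B uA uB A#B big-A big-B small κ =
    even-hole is adm even (≤-trans 0<M M≤M′) (≤-trans m≤M M≤M′) A B uA uB A#B
      (subst (_≤ length A) regroup big-A) (subst (_≤ length B) regroup big-B) small outer
    where
    M≤M′ : M ≤ 81 * M
    M≤M′ = m≤m+n M (80 * M)
    regroup : 81 ^ suc (length is) * M ≡ 81 ^ length is * (81 * M)
    regroup = trans (cong (_* M) (*-comm 81 (81 ^ length is))) (*-assoc (81 ^ length is) 81 M)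

    outer : Hole is (81 * M) A B → ⊥
    outer H = let K , p , M≤2^K , 2^K≤2M , p<M , n≡′ = cycle-shape 0<M 8M≤ m≤M n≤m ℓ≤n in
      linked K p 0<M crossing (large M≤S) (large M≤T) M≤2^K 2^K≤2M p<M n≡′ inner
      where
      open Hole H renaming (S to A′; T to B′)
      open TwoSided _≟_ (Col? i) (Col-sym i) uS uT S#T using (Crossing; Linked; linked; side-A; side-B)

      8M≤ : 8 * M ≤ 2 ^ ℓ
      8M≤ = begin
        8 * M      ≤⟨ *-monoˡ-≤ M (m≤m+n 8 73) ⟩
        81 * M     ≤⟨ M≤S ⟩
        length A′  ≤⟨ length-⊆ uS S⊆ ⟩
        length A   ≤⟨ small ⟩
        2 ^ ℓ      ∎
        where open ≤-Reasoning

      -- Beyond the `32 * M` of the regions, `3 * M` vertices are set aside; `M` of them survive the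
      -- loss of `2 * M`, enough for `crossing` to give the edge.
      large : ∀ {k} → 81 * M ≤ k → 32 * M + 3 * M ≤ k
      large = ≤-trans (≤-trans (≤-reflexive (sym (*-distribʳ-+ M 32 3))) (*-monoˡ-≤ M (m≤m+n 35 46)))

      crossing : Crossing M
      crossing S T uS′ uT′ S⊆′ T⊆′ M≤S′ M≤T′ with edge? i S T
      ... | yes e = e
      ... | no ¬e = ⊥-elim (κ (record
        { uS = uS′ ; uT = uT′ ; S⊆ = S⊆ ∘ S⊆′ ; T⊆ = T⊆ ∘ T⊆′ ; S#T = λ (s∈ , t∈) → S#T (S⊆′ s∈ , T⊆′ t∈)
        ; M≤S = M≤S′ ; M≤T = M≤T′
        ; free = λ s∈ t∈ → (λ e → ¬e (_ , _ , s∈ , t∈ , e)) ∷ free (S⊆′ s∈) (T⊆′ t∈) }))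

      parity : flips (suc n) true ≡ false
      parity = cong not (trans (cong (λ j → flips j true) n≡) (flips-double h true))

      M≤ : ∀ {k} → 3 * M ≤ k + 2 * M → M ≤ k
      M≤ {k} = +-cancelʳ-≤ (2 * M) M k

      inner : Linked M (3 * M) (3 * M) n → ⊥
      inner (E , F , uE , uF , E⊆ , F⊆ , big-E , big-F , cycle) =
        let x , y , x∈ , y∈ , e = crossing E F uE uF E⊆ F⊆ (M≤ big-E) (M≤ big-F) in
        ¬cycle (cycle (∈-++⁺ˡ x∈) (∈-++⁺ʳ E y∈)
          (λ x≡y → S#T (E⊆ x∈ , F⊆ (subst (_∈ F) (sym x≡y) y∈))) e
          (trans (side-B (F⊆ y∈)) (sym (trans (cong (flips (suc n)) (side-A (E⊆ x∈))) parity))))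

-- Copies in colourings and decidability

module _ {A : Set} where

  lookup-injective : ∀ {xs : List A} → Unique xs → Injective _≡_ _≡_ (List.lookup xs)
  lookup-injective {_ ∷ _}  _        {Fin.zero}  {Fin.zero}  _ = refl
  lookup-injective {_ ∷ _}  (px ∷ _) {Fin.zero}  {Fin.suc j} e = ⊥-elim (All.lookup px (∈-lookup j) e)
  lookup-injective {_ ∷ _}  (px ∷ _) {Fin.suc i} {Fin.zero}  e = ⊥-elim (All.lookup px (∈-lookup i) (sym e))
  lookup-injective {_ ∷ xs} (_ ∷ u)  {Fin.suc i} {Fin.suc j} e = cong Fin.suc (lookup-injective u e)

module _ {V : Set} {R : V → V → Set} where

  lookup-start : ∀ {u xs v} → Walk R u xs v → ∀ i → toℕ i ≡ 0 → List.lookup xs i ≡ u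
  lookup-start stop       Fin.zero _ = refl
  lookup-start (step _ _) Fin.zero _ = refl

  lookup-end : ∀ {u xs v} → Walk R u xs v → ∀ i → suc (toℕ i) ≡ length xs → List.lookup xs i ≡ v
  lookup-end stop                Fin.zero    _ = refl
  lookup-end (step _ w)          (Fin.suc i) e = lookup-end w i (suc-injective e)
  lookup-end (step _ stop)       Fin.zero    ()
  lookup-end (step _ (step _ _)) Fin.zero    ()

  lookup-next : ∀ {u xs v} → Walk R u xs v → ∀ i j → suc (toℕ i) ≡ toℕ j → R (List.lookup xs i) (List.lookup xs j)
  lookup-next stop       Fin.zero    (Fin.suc ()) e
  lookup-next (step r w) Fin.zero    (Fin.suc j) e =
    subst (R _) (sym (lookup-start w j (sym (suc-injective e)))) r
  lookup-next (step r w) (Fin.suc i) (Fin.suc j) e = lookup-next w i j (suc-injective e)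

module _ {N k} (c : EdgeColouring N k) (i : Fin k) where

  open EdgeColouring c

  closedWalk⇒copy : ∀ {n} → ClosedWalk (λ u v → colour u v ≡ i) n → MonochromaticCopy c i (Cycle n)
  closedWalk⇒copy (u , v , xs , w , r , uxs , refl) = List.lookup xs , lookup-injective uxs , edge
    where
    next : ∀ a b → Next a b → colour (List.lookup xs a) (List.lookup xs b) ≡ i
    next a b (inj₁ e)       = lookup-next w a b e
    next a b (inj₂ (e , z)) = subst₂ (λ p q → colour p q ≡ i) (sym (lookup-end w a e)) (sym (lookup-start w b z)) r
    edge : ∀ a b → Graph.Adj (Cycle (length xs)) a b → colour (List.lookup xs a) (List.lookup xs b) ≡ i
    edge a b (_ , inj₁ n) = next a b n
    edge a b (_ , inj₂ n) = trans (symmetric _ _) (next b a n)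

  biclique⇒copy : ∀ {m S T} → Unique S → Unique T → Disjoint S T → m ≤ length S → m ≤ length T →
    (∀ {s t} → s ∈ S → t ∈ T → colour s t ≡ i) → MonochromaticCopy c i (CompleteBipartite m m)
  biclique⇒copy {m} {S} {T} uS uT S#T m≤S m≤T all-i = f , inj , edge
    where
    f : Fin m ⊎ Fin m → Fin N
    f (inj₁ a) = List.lookup S (inject≤ a m≤S)
    f (inj₂ b) = List.lookup T (inject≤ b m≤T)
    f₁∈ : ∀ a → f (inj₁ a) ∈ S
    f₁∈ a = ∈-lookup (inject≤ a m≤S)
    f₂∈ : ∀ b → f (inj₂ b) ∈ T
    f₂∈ b = ∈-lookup (inject≤ b m≤T)
    inj : Injective _≡_ _≡_ f
    inj {inj₁ a} {inj₁ b} e = cong inj₁ (Fin.inject≤-injective m≤S m≤S a b (lookup-injective uS e))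
    inj {inj₂ a} {inj₂ b} e = cong inj₂ (Fin.inject≤-injective m≤T m≤T a b (lookup-injective uT e))
    inj {inj₁ a} {inj₂ b} e = ⊥-elim (S#T (f₁∈ a , subst (_∈ T) (sym e) (f₂∈ b)))
    inj {inj₂ a} {inj₁ b} e = ⊥-elim (S#T (f₁∈ b , subst (_∈ T) e (f₂∈ a)))
    edge : ∀ a b → Graph.Adj (CompleteBipartite m m) a b → colour (f a) (f b) ≡ i
    edge (inj₁ a) (inj₂ b) _ = all-i (f₁∈ a) (f₂∈ b)
    edge (inj₂ a) (inj₁ b) _ = trans (symmetric _ _) (all-i (f₁∈ b) (f₂∈ a))

-- Makes copies of `G` searchable by enumerating maps as elements of `Fin (N ^ size)`. Decidability
-- serves to remove the double negations of the main argument and to find the least `N`.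
record FiniteGraph (G : Graph) : Set where
  open Graph G using (V; Adj)
  field
    {size}    : ℕ
    encode    : V → Fin size
    decode    : Fin size → V
    decode-encode : ∀ v → decode (encode v) ≡ v
    Adj?      : Decidable₂ Adj

  all-V? : ∀ {P : V → Set} → Decidable P → Dec (∀ v → P v)
  all-V? {P} P? = map′ (λ h v → subst P (decode-encode v) (h (encode v))) (_∘ decode) (Fin.all? (P? ∘ decode))

  _≟ⱽ_ : DecidableEquality V
  u ≟ⱽ v = map′ (λ e → trans (sym (decode-encode u)) (trans (cong decode e) (decode-encode v))) (cong encode)
    (encode u Fin.≟ encode v)

  copy? : ∀ {N k} (c : EdgeColouring N k) i → Dec (MonochromaticCopy c i G)
  copy? {N} c i = map′
    (λ (g , p) → finToFun g ∘ encode , p)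
    (λ (f , p) → funToFin (f ∘ decode) , transfer
      (λ v → trans (cong f (sym (decode-encode v))) (sym (finToFun-funToFin (f ∘ decode) (encode v)))) p)
    (Fin.any? {N ^ size} (λ g → isCopy? (finToFun g ∘ encode)))
    where
    open EdgeColouring c
    IsCopy : (V → Fin N) → Set
    IsCopy f = Injective _≡_ _≡_ f × (∀ u v → Adj u v → colour (f u) (f v) ≡ i)
    transfer : ∀ {f g} → (∀ v → f v ≡ g v) → IsCopy f → IsCopy g
    transfer f≗g (inj , edge) =
      (λ e → inj (trans (f≗g _) (trans e (sym (f≗g _))))) ,
      (λ u v a → subst₂ (λ p q → colour p q ≡ i) (f≗g u) (f≗g v) (edge u v a))
    isCopy? : Decidable IsCopy
    isCopy? f =
      map′ (λ h e → h _ _ e) (λ h _ _ e → h e)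
        (all-V? λ u → all-V? λ v → (f u Fin.≟ f v) →-dec (u ≟ⱽ v))
      ×-dec all-V? λ u → all-V? λ v → Adj? u v →-dec (colour (f u) (f v) Fin.≟ i)

cycle-finite : ∀ n → FiniteGraph (Cycle n)
cycle-finite n = record
  { encode = id ; decode = id ; decode-encode = λ _ → refl
  ; Adj? = λ i j → ¬? (i Fin.≟ j) ×-dec (next? i j ⊎-dec next? j i) }
  where
  next? : ∀ i j → Dec (Next {n} i j)
  next? i j = (suc (toℕ i) ≟ toℕ j) ⊎-dec ((suc (toℕ i) ≟ n) ×-dec (toℕ j ≟ 0))

completeBipartite-finite : ∀ a b → FiniteGraph (CompleteBipartite a b)
completeBipartite-finite a b = record
  { encode = Fin.join a b ; decode = Fin.splitAt a ; decode-encode = Fin.splitAt-join a b ; Adj? = adj? }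
  where
  adj? : Decidable₂ (Graph.Adj (CompleteBipartite a b))
  adj? (inj₁ _) (inj₁ _) = no λ ()
  adj? (inj₁ _) (inj₂ _) = yes _
  adj? (inj₂ _) (inj₁ _) = yes _
  adj? (inj₂ _) (inj₂ _) = no λ ()

module _ {k} (Gs : Vec Graph k) (finite : ∀ i → FiniteGraph (lookup Gs i)) where

  anyCopy? : ∀ {N} (c : EdgeColouring N k) → Dec (∃[ i ] MonochromaticCopy c i (lookup Gs i))
  anyCopy? c = Fin.any? λ i → FiniteGraph.copy? (finite i) c i

  -- Colourings are enumerated by codes in `Fin ((k ^ N) ^ N)`; a code of a non-symmetric function
  -- satisfies its condition vacuously.
  arrows? : ∀ N → Dec (Arrows N Gs)
  arrows? N = map′ to (λ arrows e s → arrows (decoded e s)) (Fin.all? decide)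
    where
    col : Fin ((k ^ N) ^ N) → Fin N → Fin N → Fin k
    col e u = finToFun (finToFun e u)
    Sym : Fin ((k ^ N) ^ N) → Set
    Sym e = ∀ u v → col e u v ≡ col e v u
    decoded : ∀ e → Sym e → EdgeColouring N k
    decoded e s = record { colour = col e ; symmetric = s }
    decide : ∀ e → Dec (∀ s → ∃[ i ] MonochromaticCopy (decoded e s) i (lookup Gs i))
    decide e with Fin.all? (λ u → Fin.all? λ v → col e u v Fin.≟ col e v u)
    ... | yes s = map′ (λ copy _ → copy) (λ h → h s) (anyCopy? (decoded e s))
    ... | no ¬s = yes λ s → ⊥-elim (¬s s)
    to : (∀ e (s : Sym e) → ∃[ i ] MonochromaticCopy (decoded e s) i (lookup Gs i)) → Arrows N Gs
    to all c = let i , f , inj , edge = all e sym-e in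
      -- The decoded colouring agrees with `c` only pointwise, so the copy is carried over along
      -- `col-e`.
      i , f , inj , λ u v a → trans (sym (col-e (f u) (f v))) (edge u v a)
      where
      open EdgeColouring c
      e : Fin ((k ^ N) ^ N)
      e = funToFin (λ u → funToFin (colour u))
      col-e : ∀ u v → col e u v ≡ colour u v
      col-e u v = trans (cong (λ x → finToFun x v) (finToFun-funToFin (λ u → funToFin (colour u)) u))
        (finToFun-funToFin (colour u) v)
      sym-e : Sym e
      sym-e u v = trans (col-e u v) (trans (symmetric u v) (sym (col-e v u)))

least : ∀ {P : ℕ → Set} → Decidable P → ∀ N → P N → ∃[ r ] r ≤ N × P r × (∀ M → P M → r ≤ M)
least {P} P? N pN = go N 0 (+-identityʳ N) (λ _ _ → z≤n)
  where
  go : ∀ fuel k → fuel + k ≡ N → (∀ M → P M → k ≤ M) → ∃[ r ] r ≤ N × P r × (∀ M → P M → r ≤ M)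
  go zero       k refl low = k , ≤-refl , pN , low
  go (suc fuel) k eq   low with P? k
  ... | yes pk = k , subst (k ≤_) eq (m≤n+m k (suc fuel)) , pk , low
  ... | no ¬pk = go fuel (suc k) (trans (+-suc fuel k) eq)
    λ M pM → ≤∧≢⇒< (low M pM) λ { refl → ¬pk pM }

-- The numerical bound

open import Data.Integer.Base as ℤ using (ℤ; +_; -[1+_])
import Data.Integer.Properties as ℤ
open import Data.Rational.Base as ℚ using (_/_; toℚᵘ)
import Data.Rational.Properties as ℚ
open import Data.Rational.Unnormalised.Base as ℚᵘ using (mkℚᵘ; *≤*)
import Data.Rational.Unnormalised.Properties as ℚᵘ

/-≃ : ∀ z d → toℚᵘ (z / suc d) ℚᵘ.≃ mkℚᵘ z d
/-≃ z d = ℚ.toℚᵘ-fromℚᵘ (mkℚᵘ z d)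

/-mono-≤ : ∀ {a b} d → a ≤ b → (+ a / suc d) ℚ.≤ (+ b / suc d)
/-mono-≤ {a} {b} d a≤b = ℚ.toℚᵘ-cancel-≤ (begin
  toℚᵘ (+ a / suc d)  ≃⟨ /-≃ (+ a) d ⟩
  mkℚᵘ (+ a) d        ≤⟨ *≤* (ℤ.*-monoʳ-≤-nonNeg (+ suc d) (ℤ.+≤+ a≤b)) ⟩
  mkℚᵘ (+ b) d        ≃⟨ /-≃ (+ b) d ⟨
  toℚᵘ (+ b / suc d)  ∎)
  where open ℚᵘ.≤-Reasoning

/-cancel-≤ : ∀ {a b c d} → (+ a / suc c) ℚ.≤ (+ b / suc d) → a * suc d ≤ b * suc c
/-cancel-≤ {a} {b} {c} {d} h = ℤ.drop‿+≤+ (subst₂ ℤ._≤_ (sym (ℤ.pos-* a (suc d))) (sym (ℤ.pos-* b (suc c)))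
  (ℚᵘ.drop-*≤* (begin
    mkℚᵘ (+ a) c        ≃⟨ /-≃ (+ a) c ⟨
    toℚᵘ (+ a / suc c)  ≤⟨ ℚ.toℚᵘ-mono-≤ h ⟩
    toℚᵘ (+ b / suc d)  ≃⟨ /-≃ (+ b) d ⟩
    mkℚᵘ (+ b) d        ∎)))
  where open ℚᵘ.≤-Reasoning

/1-* : ∀ a b → (+ a / 1) ℚ.* (+ b / 1) ≡ + (a * b) / 1
/1-* a b = ℚ.toℚᵘ-injective (begin-equality
  toℚᵘ ((+ a / 1) ℚ.* (+ b / 1))          ≃⟨ ℚ.toℚᵘ-homo-* (+ a / 1) (+ b / 1) ⟩
  toℚᵘ (+ a / 1) ℚᵘ.* toℚᵘ (+ b / 1)      ≃⟨ ℚᵘ.*-cong (/-≃ (+ a) 0) (/-≃ (+ b) 0) ⟩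
  mkℚᵘ (+ a) 0 ℚᵘ.* mkℚᵘ (+ b) 0          ≡⟨ cong (λ z → mkℚᵘ z 0) (sym (ℤ.pos-* a b)) ⟩
  mkℚᵘ (+ (a * b)) 0                      ≃⟨ /-≃ (+ (a * b)) 0 ⟨
  toℚᵘ (+ (a * b) / 1)                    ∎)
  where open ℚᵘ.≤-Reasoning

-- As `34 ≤ c`, the new factor is at most `2 * c * c`. The factor 2 is absorbed by `2 * b ≤ a`, and
-- the rest is the square of `a * c ≤ b * X`.
square-step : ∀ a b c X .{{_ : NonZero b}} → 2 * b ≤ a → 34 ≤ c → a * c ≤ b * X → a * (c * (34 + c)) ≤ b * (X * X)
square-step a b c X 2b≤a 34≤c ac≤bX = *-cancelˡ-≤ b (begin
  b * (a * (c * (34 + c)))  ≤⟨ *-monoʳ-≤ b (*-monoʳ-≤ a (*-monoʳ-≤ c (+-monoˡ-≤ c 34≤c))) ⟩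
  b * (a * (c * (c + c)))   ≡⟨ arith₁ a b c ⟩
  (2 * b * c) * (a * c)     ≤⟨ *-monoˡ-≤ (a * c) (*-monoˡ-≤ c 2b≤a) ⟩
  (a * c) * (a * c)         ≤⟨ *-mono-≤ ac≤bX ac≤bX ⟩
  (b * X) * (b * X)         ≡⟨ arith₂ b X ⟩
  b * (b * (X * X))         ∎)
  where
  open ≤-Reasoning
  arith₁ : ∀ a b c → b * (a * (c * (c + c))) ≡ (2 * b * c) * (a * c)
  arith₁ = solve-∀
  arith₂ : ∀ b X → (b * X) * (b * X) ≡ b * (b * (X * X))
  arith₂ = solve-∀

hole-factor>0 : ∀ k → 0 < hole-factor k
hole-factor>0 zero    = z<s
hole-factor>0 (suc k) = *-mono-≤ (hole-factor>0 k) (s≤s (z≤n {33 + hole-factor k}))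

34≤hole-factor : ∀ k → 34 ≤ hole-factor (suc k)
34≤hole-factor k = ≤-trans (m≤m+n 34 (hole-factor k))
  (m≤n*m (34 + hole-factor k) (hole-factor k) {{ℕ.>-nonZero (hole-factor>0 k)}})

-- The factor `35 ^ 2` clears the `- 2` in the exponent, and increasing `k` squares
-- `35 ^ (2 ^ suc k)`. The induction begins with 72, a value above the 34 that `square-step`
-- requires.
hole-factor-bound : ∀ k → 35 ^ 2 * hole-factor (suc k) ≤ 82 * 35 ^ (2 ^ suc k)
hole-factor-bound zero    = ≤ᵇ⇒≤ (35 ^ 2 * 72) (82 * 35 ^ 2) _
hole-factor-bound (suc k) = subst (λ X → 35 ^ 2 * hole-factor (2 + k) ≤ 82 * X) (sym power)
  (square-step (35 ^ 2) 82 (hole-factor (suc k)) (35 ^ (2 ^ suc k))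
    (≤ᵇ⇒≤ 164 (35 ^ 2) _) (34≤hole-factor k) (hole-factor-bound k))
  where
  power : 35 ^ (2 ^ (2 + k)) ≡ 35 ^ (2 ^ suc k) * 35 ^ (2 ^ suc k)
  power = trans (cong (λ j → 35 ^ (2 ^ suc k + j)) (+-identityʳ (2 ^ suc k)))
    (^-distribˡ-+-* 35 (2 ^ suc k) (2 ^ suc k))

hole-factor-≤ : ∀ k → (+ hole-factor k / 1) ℚ.≤ (+ 82 / 1) ℚ.* 35 ^ℤ (+ (2 ^ k) ℤ.- + 2)
-- Without odd cycles the exponent is -1, and the claim is 2 ≤ 82/35.
hole-factor-≤ zero    = from-yes ((+ 2 / 1) ℚ.≤? ((+ 82 / 1) ℚ.* (+ 1 / 35)))
hole-factor-≤ (suc k) = subst (λ z → (+ hole-factor (suc k) / 1) ℚ.≤ (+ 82 / 1) ℚ.* 35 ^ℤ z) (sym exponent)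
  (subst ((+ hole-factor (suc k) / 1) ℚ.≤_) (sym (/1-* 82 (35 ^ j))) (/-mono-≤ 0 small))
  where
  j : ℕ
  j = 2 ^ suc k ∸ 2
  2≤ : 2 ≤ 2 ^ suc k
  2≤ = *-monoʳ-≤ 2 (m^n>0 2 k)
  exponent : + (2 ^ suc k) ℤ.- + 2 ≡ + j
  exponent = trans (ℤ.m-n≡m⊖n (2 ^ suc k) 2) (ℤ.⊖-≥ 2≤)
  small : hole-factor (suc k) ≤ 82 * 35 ^ j
  small = *-cancelˡ-≤ (35 ^ 2) (begin
    35 ^ 2 * hole-factor (suc k)  ≤⟨ hole-factor-bound k ⟩
    82 * 35 ^ (2 ^ suc k)         ≡⟨ cong (λ e → 82 * 35 ^ e) (m+[n∸m]≡n 2≤) ⟨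
    82 * 35 ^ (2 + j)             ≡⟨ cong (82 *_) (^-distribˡ-+-* 35 2 j) ⟩
    82 * (35 ^ 2 * 35 ^ j)        ≡⟨ swap-* 82 (35 ^ 2) (35 ^ j) ⟩
    35 ^ 2 * (82 * 35 ^ j)        ∎)
    where
    open ≤-Reasoning
    swap-* : ∀ a b c → a * (b * c) ≡ b * (a * c)
    swap-* = solve-∀

-- A natural number below the rational `bound`; the colourings are studied on this many vertices.
order : ∀ {t} → Vec ℕ t → ℕ → ℕ
order ns m = hole-factor (#odd ns) * (81 ^ #even ns * m)

order-≤-bound : ∀ {t} (ns : Vec ℕ t) m → (+ order ns m / 1) ℚ.≤ bound ns m
order-≤-bound ns m = subst (ℚ._≤ bound ns m) eq
  (ℚ.*-monoʳ-≤-nonNeg (+ m / 1) {{ℚ.normalize-nonNeg m 1}}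
    (ℚ.*-monoʳ-≤-nonNeg (+ (81 ^ e) / 1) {{ℚ.normalize-nonNeg (81 ^ e) 1}}
      (hole-factor-≤ (#odd ns))))
  where
  e : ℕ
  e = #even ns
  h : ℕ
  h = hole-factor (#odd ns)
  eq : (+ h / 1) ℚ.* (+ (81 ^ e) / 1) ℚ.* (+ m / 1) ≡ + order ns m / 1
  eq = trans (cong (ℚ._* (+ m / 1)) (/1-* h (81 ^ e)))
    (trans (/1-* (h * 81 ^ e) m) (cong (λ k → + k / 1) (*-assoc h (81 ^ e) m)))

-- A negative exponent would give a power of 2 below 1.
≤-2^ℤ : ∀ {n} ℓ → 0 < n → (+ n / 1) ℚ.≤ 2 ^ℤ ℓ → ∃[ l ] ℓ ≡ + l × n ≤ 2 ^ l
≤-2^ℤ {n} (+ l) _ h = l , refl , subst₂ _≤_ (*-identityʳ n) (*-identityʳ (2 ^ l)) (/-cancel-≤ {n} {2 ^ l} {0} {0} h)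
≤-2^ℤ {n} -[1+ k ] 0<n h = ⊥-elim (<-irrefl refl (begin-strict
  1                ≤⟨ 0<n ⟩
  n                <⟨ m<m*n n (2 ^ suc k) {{ℕ.>-nonZero 0<n}} (*-mono-≤ (≤-refl {2}) (m^n>0 2 k)) ⟩
  n * 2 ^ suc k    ≤⟨ cancel (2 ^ suc k) {{m^n≢0 2 (suc k)}} h ⟩
  1                ∎))
  where
  open ≤-Reasoning
  cancel : ∀ d .{{_ : NonZero d}} → (+ n / 1) ℚ.≤ (+ 1 / d) → n * d ≤ 1
  cancel (suc d) = /-cancel-≤ {n} {1} {0} {d}

-- Colours sorted by parity, and the theorem

module _ {P : ℕ → Set} (P? : Decidable P) where

  indices : ∀ {t} → Vec ℕ t → List (Fin t)
  indices []       = []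
  indices (n ∷ ns) with P? n
  ... | yes _ = Fin.zero ∷ List.map Fin.suc (indices ns)
  ... | no  _ = List.map Fin.suc (indices ns)

  length-indices : ∀ {t} (ns : Vec ℕ t) → length (indices ns) ≡ count P? ns
  length-indices []       = refl
  length-indices (n ∷ ns) with P? n
  ... | yes _ = cong suc (trans (length-map Fin.suc (indices ns)) (length-indices ns))
  ... | no  _ = trans (length-map Fin.suc (indices ns)) (length-indices ns)

  indices⁺ : ∀ {t} (ns : Vec ℕ t) i → P (lookup ns i) → i ∈ indices ns
  indices⁺ (n ∷ ns) Fin.zero p with P? n
  ... | yes _ = here refl
  ... | no ¬p = ⊥-elim (¬p p)
  indices⁺ (n ∷ ns) (Fin.suc i) p with P? n
  ... | yes _ = there (∈-map⁺ Fin.suc (indices⁺ ns i p))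
  ... | no  _ = ∈-map⁺ Fin.suc (indices⁺ ns i p)

  indices⁻ : ∀ {t} (ns : Vec ℕ t) → All (λ i → P (lookup ns i)) (indices ns)
  indices⁻ []       = []
  indices⁻ (n ∷ ns) with P? n
  ... | yes p = p ∷ All.map⁺ (indices⁻ ns)
  ... | no  _ = All.map⁺ (indices⁻ ns)

parity : ∀ n → (∃[ h ] n ≡ h + h) ⊎ (∃[ h ] n ≡ suc (h + h))
parity zero    = inj₁ (0 , refl)
parity (suc n) with parity n
... | inj₁ (h , eq) = inj₂ (h , cong suc eq)
... | inj₂ (h , eq) = inj₁ (suc h , trans (cong suc eq) (cong suc (sym (+-suc h h))))

double-even : ∀ h → 2 ∣ h + h
double-even h = divides h (trans (cong (λ k → h + k) (sym (+-identityʳ h))) (*-comm 2 h))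

even⇒double : ∀ {n} → 2 ∣ n → ∃[ h ] n ≡ h + h
even⇒double {n} (divides h eq) = h , trans eq (trans (*-comm h 2) (cong (λ k → h + k) (+-identityʳ h)))

odd⇒suc-double : ∀ {n} → ¬ 2 ∣ n → ∃[ h ] n ≡ suc (h + h)
odd⇒suc-double {n} odd with parity n
... | inj₁ (h , refl) = ⊥-elim (odd (double-even h))
... | inj₂ p          = p

module _ {t} (Gs : Vec Graph t) (G : Graph) where

  lookup-∷ʳ-inject₁ : ∀ i → lookup (Gs ∷ʳ G) (inject₁ i) ≡ lookup Gs i
  lookup-∷ʳ-inject₁ = go Gs
    where
    go : ∀ {t} (Gs : Vec Graph t) i → lookup (Gs ∷ʳ G) (inject₁ i) ≡ lookup Gs i
    go (_ ∷ _)  Fin.zero    = refl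
    go (_ ∷ Gs) (Fin.suc i) = go Gs i

  lookup-∷ʳ-fromℕ : lookup (Gs ∷ʳ G) (fromℕ t) ≡ G
  lookup-∷ʳ-fromℕ = go Gs
    where
    go : ∀ {t} (Gs : Vec Graph t) → lookup (Gs ∷ʳ G) (fromℕ t) ≡ G
    go []       = refl
    go (_ ∷ Gs) = go Gs

module _ {t} (ns : Vec ℕ t) (m : ℕ) where

  targets : Vec Graph (suc t)
  targets = map Cycle ns ∷ʳ CompleteBipartite m m

  cycle-target : ∀ i → lookup targets (inject₁ i) ≡ Cycle (lookup ns i)
  cycle-target i = trans (lookup-∷ʳ-inject₁ (map Cycle ns) _ i) (Vec.lookup-map i Cycle ns)

  biclique-target : lookup targets (fromℕ t) ≡ CompleteBipartite m m
  biclique-target = lookup-∷ʳ-fromℕ (map Cycle ns) _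

  targets-finite : ∀ i → FiniteGraph (lookup targets i)
  targets-finite i with view i
  ... | ‵fromℕ     = subst FiniteGraph (sym biclique-target) (completeBipartite-finite m m)
  ... | ‵inject₁ j = subst FiniteGraph (sym (cycle-target j)) (cycle-finite (lookup ns j))

  -- The odd colours come first, with hole size `M₁`; the two sides of that hole are the input for
  -- the even colours, which reduce `M₁` to `m`.
  arrows : ∀ ℓ → 0 < m → order ns m ≤ 2 ^ ℓ →
    (∀ i → lookup ns i ≤ m × 2 * suc ℓ ≤ lookup ns i) → Arrows (order ns m) targets
  -- The existence of a monochromatic copy is decidable, so the holes may be used under double
  -- negation.
  arrows ℓ 0<m N≤2^ℓ lengths c = decidable-stable (anyCopy? targets targets-finite c) contra
    where
    open EdgeColouring c
    open Coloured Fin._≟_ Fin._≟_ colour symmetric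

    tagged : List (Fin t) → List (Fin (suc t) × ℕ)
    tagged = List.map (λ i → inject₁ i , lookup ns i)

    odds evens : List (Fin t)
    odds  = indices (λ n → ¬? (2 ∣? n)) ns
    evens = indices (2 ∣?_) ns

    |odds| : length (tagged odds) ≡ #odd ns
    |odds| = trans (length-map _ odds) (length-indices _ ns)

    |evens| : length (tagged evens) ≡ #even ns
    |evens| = trans (length-map _ evens) (length-indices _ ns)

    M₁ : ℕ
    M₁ = 81 ^ #even ns * m

    m≤M₁ : m ≤ M₁
    m≤M₁ = m≤n*m m (81 ^ #even ns) {{m^n≢0 81 (#even ns)}}

    vertices : List (Fin (order ns m))
    vertices = allFin (order ns m)

    |vertices| : length vertices ≡ order ns m
    |vertices| = length-tabulate id

    contra : ¬ ¬ (∃[ i ] MonochromaticCopy c i (lookup targets i))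
    contra no-copy =
      odd-hole (tagged odds) (admissible odds) (All.map⁺ (All.map odd⇒suc-double (indices⁻ _ ns)))
        (≤-trans 0<m m≤M₁) m≤M₁ vertices (Uniq.allFin⁺ _)
        (≤-reflexive (trans (cong (λ k → hole-factor k * M₁) |odds|) (sym |vertices|)))
        (≤-trans (≤-reflexive |vertices|) N≤2^ℓ) λ H₁ →
      even-hole (tagged evens) (admissible evens) (All.map⁺ (All.map even⇒double (indices⁻ _ ns)))
        0<m ≤-refl (Hole.S H₁) (Hole.T H₁) (Hole.uS H₁) (Hole.uT H₁) (Hole.S#T H₁)
        (≤-trans (≤-reflexive (cong (λ k → 81 ^ k * m) |evens|)) (Hole.M≤S H₁))
        (≤-trans (≤-reflexive (cong (λ k → 81 ^ k * m) |evens|)) (Hole.M≤T H₁))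
        (≤-trans (length-⊆ (Hole.uS H₁) (Hole.S⊆ H₁)) (≤-trans (≤-reflexive |vertices|) N≤2^ℓ)) λ H₂ →
      no-copy (fromℕ t , subst (MonochromaticCopy c (fromℕ t)) (sym biclique-target)
        (biclique⇒copy c (fromℕ t) (Hole.uS H₂) (Hole.uT H₂) (Hole.S#T H₂) (Hole.M≤S H₂) (Hole.M≤T H₂)
          λ s∈ t∈ → last-colour (Hole.free H₁ (Hole.S⊆ H₂ s∈) (Hole.T⊆ H₂ t∈)) (Hole.free H₂ s∈ t∈)))
      where
      admissible : ∀ js → All (Admissible ℓ m) (tagged js)
      admissible js = All.map⁺ (All.universal (λ i → proj₁ (lengths i) , proj₂ (lengths i) , λ w →
        no-copy (inject₁ i , subst (MonochromaticCopy c (inject₁ i)) (sym (cycle-target i))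
          (closedWalk⇒copy c (inject₁ i) w))) js)

      -- A cycle colour occurs in one of the two lists according to the parity of its length, so a
      -- colour avoiding both lists is the last one.
      last-colour : ∀ {i} → All (λ (j , _) → i ≢ j) (tagged odds) →
        All (λ (j , _) → i ≢ j) (tagged evens) → i ≡ fromℕ t
      last-colour {i} ¬odd ¬even with view i
      ... | ‵fromℕ     = refl
      ... | ‵inject₁ j with 2 ∣? lookup ns j
      ...   | yes e = ⊥-elim (All.lookup ¬even (∈-map⁺ _ (indices⁺ (2 ∣?_) ns j e)) refl)
      ...   | no  o = ⊥-elim (All.lookup ¬odd (∈-map⁺ _ (indices⁺ (λ n → ¬? (2 ∣? n)) ns j o)) refl)

order>0 : ∀ {t} (ns : Vec ℕ t) {m} → 0 < m → 0 < order ns m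
order>0 ns {m} 0<m = *-mono-≤ (hole-factor>0 (#odd ns)) (*-mono-≤ (m^n>0 81 (#even ns)) 0<m)

theorem2p12 : ∀ (t : ℕ) (ns : Vec ℕ t) (m : ℕ) →
    (∀ i → 0 ℕ.< lookup ns i) →
    0 ℕ.< m →
    (ℓ : ℤ) → IsCeilLog₂ (bound ns m) ℓ →
    (∀ i → m ℕ.≥ lookup ns i × + lookup ns i ℤ.≥ + 2 ℤ.* (ℓ ℤ.+ + 1)) →
    ∃[ r ] IsRamseyNumber (map Cycle ns ∷ʳ CompleteBipartite m m) r × (+ r / 1) ℚ.≤ bound ns m
theorem2p12 t ns m _ 0<m ℓ (bound≤ , _) lengths =
  -- `order ns m` is at most `bound ns m`, hence at most `2 ^ℤ ℓ`; this makes `ℓ` a natural number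
  -- `l`. The Ramsey number is then the least arrowing number, found at or below `order ns m`.
  let l , ℓ≡ , N≤2^l = ≤-2^ℤ ℓ (order>0 ns 0<m) (ℚ.≤-trans (order-≤-bound ns m) bound≤)
      long = λ i → drop-+ (subst (λ z → + lookup ns i ℤ.≥ + 2 ℤ.* (z ℤ.+ + 1)) ℓ≡ (proj₂ (lengths i)))
      r , r≤N , arrows-r , minimal = least (arrows? (targets ns m) (targets-finite ns m)) (order ns m)
        (arrows ns m l 0<m N≤2^l λ i → proj₁ (lengths i) , long i)
  in r , (arrows-r , minimal) , ℚ.≤-trans (/-mono-≤ 0 r≤N) (order-≤-bound ns m)
  where
  drop-+ : ∀ {l n} → + n ℤ.≥ + 2 ℤ.* (+ l ℤ.+ + 1) → 2 * suc l ≤ n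
  drop-+ {l} {n} h = ℤ.drop‿+≤+ (subst (ℤ._≤ + n)
    (trans (sym (ℤ.pos-* 2 (l + 1))) (cong (λ k → + (2 * k)) (+-comm l 1))) h)
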